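{- Let $U$ be a graph. The following properties are equivalent: (1) There are two graphs $G$ and $G'$ (on the same vertex set) having the same $3$-element homogeneous subsets such that $U=G\dot{+}G'$. (2) $S(U)$ and $S(\overline U)$ are bipartite. (3) Either (i) $U$ is (up to isomorphism) an induced subgraph of $P_9$, or (ii) the connected components of $U$, or of its complement $\overline U$, are cycles of even length, paths or isolated vertices.
   Context: Graphs are undirected, simple and loopless: a graph is a pair $(V,\mathcal E)$ with $\mathcal E\subseteq [V]^2$, the set of $2$-element subsets of $V$. The complement of $G=(V,\mathcal E)$ is $\overline G=(V,[V]^2\setminus\mathcal E)$. The graph induced by $G$ on $A\subseteq V$ is $(A,\mathcal E\cap [A]^2)$. A subset of vertices of a graph is homogeneous if it is a clique or an independent set. The Boolean sum $G\dot{+}G'$ of two graphs $G$ and $G'$ on the same vertex set $V$ is the graph on $V$ whose edge set is the symmetric difference $E(G)\,\Delta\, E(G')$. The edge-graph $S(U)$ of a graph $U$ is the graph whose vertices are the edges of $U$ and whose edges are the unordered pairs $\{u,v\}$ such that $u=\{x,y\}$, $v=\{x,z\}$ for three distinct vertices $x,y,z$ of $U$ such that $\{y,z\}$ is not an edge of $U$. $P_9$ is the Paley graph on $9$ vertices, isomorphic to the cartesian product $K_3\Box K_3$ (where $K_3$ is the complete graph on $3$ vertices): its vertices are the pairs $(i,j)$ with $i,j\in\{0,1,2\}$, two distinct pairs being adjacent iff they agree in exactly one coordinate. -}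

module Defs where

open import Data.Bool.Base using (Bool)
open import Data.Fin.Base using (Fin; toℕ)
open import Data.Integer.Base as ℤ using (ℤ)
open import Data.Integer.Properties as ℤₚ using ()
open import Data.Nat.Base using (ℕ; suc; _≤_; s≤s)
open import Data.Nat.Divisibility using (_∣_)
open import Data.Nat.Properties using (1+n≢n)
open import Data.Product.Base using (Σ-syntax; ∃-syntax; _×_; _,_; proj₁; proj₂)
open import Data.Sum.Base using (_⊎_; inj₁; inj₂)
open import Function.Bundles using (Func; Inverse; _⇔_)
open import Level using (0ℓ)
open import Relation.Binary.Bundles using (Setoid)
open import Relation.Binary.Construct.Closure.ReflexiveTransitive using (Star)
open import Relation.Binary.Construct.Closure.Symmetric as Sym using (SymClosure; fwd; bwd)
open import Relation.Binary.Construct.Union using (_∪_)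
open import Relation.Binary.Core using (Rel)
open import Relation.Binary.Definitions using (Symmetric; Irreflexive; _Respects₂_)
open import Relation.Binary.PropositionalEquality using (_≡_; _≢_; refl; sym; trans; cong; setoid)
open import Relation.Nullary.Negation using (¬_)
open import Relation.Unary using (Pred; _∈_)

-- The axiom of choice, as existence of a system of representatives for every
-- equivalence relation (an AC with a conclusion up to ≈ only would be a
-- theorem of type theory).  It implies excluded middle on Set, by applying it
-- to Bool with the relation  b ≡ b′ ⊎ P.
-- For infinite graphs some choice is needed: 2-colouring S(U) for U a disjoint
-- union of 3-vertex paths chooses an edge from each path.
AxiomOfChoice : Set₁
AxiomOfChoice = (S : Setoid 0ℓ 0ℓ) → let open Setoid S in
  Σ[ rep ∈ (Carrier → Carrier) ]
    (∀ x → rep x ≈ x) × (∀ {x y} → x ≈ y → rep x ≡ rep y)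

-- The vertex set is a setoid because the vertices of an edge-graph are
-- unordered pairs, and those of an induced subgraph are elements of a subset
-- (without regard to the proof of membership).
record Graph (V : Setoid 0ℓ 0ℓ) : Set₁ where
  open Setoid V using (Carrier; _≈_)
  field
    Adj      : Rel Carrier 0ℓ
    adj-sym  : Symmetric Adj
    adj-irr  : Irreflexive _≈_ Adj
    adj-resp : Adj Respects₂ _≈_

open Graph public using (Adj)

private
  variable
    V W : Setoid 0ℓ 0ℓ

-- Equality of graphs on the same vertex set.
infix 4 _≐_
_≐_ : Graph V → Graph V → Set
_≐_ G H = ∀ x y → Adj G x y ⇔ Adj H x y

infix 4 _≅_
_≅_ : Graph V → Graph W → Set
_≅_ {V} {W} G H = Σ[ f ∈ Inverse V W ]
  (∀ x y → Adj G x y ⇔ Adj H (Inverse.to f x) (Inverse.to f y))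

complement : Graph V → Graph V
complement {V} G = record
  { Adj      = λ x y → ¬ (x ≈ y) × ¬ Adj G x y
  ; adj-sym  = λ (x≉y , ¬xy) → (λ y≈x → x≉y (≈-sym y≈x)) , (λ yx → ¬xy (adj-sym yx))
  ; adj-irr  = λ x≈y (x≉y , _) → x≉y x≈y
  ; adj-resp = (λ y≈z (x≉y , ¬xy) →
                   (λ x≈z → x≉y (≈-trans x≈z (≈-sym y≈z)))
                 , (λ xz → ¬xy (proj₁ adj-resp (≈-sym y≈z) xz)))
             , (λ y≈z (y≉x , ¬yx) →
                   (λ z≈x → y≉x (≈-trans y≈z z≈x))
                 , (λ zx → ¬yx (proj₂ adj-resp (≈-sym y≈z) zx)))
  }
  where
  open Setoid V using (_≈_) renaming (sym to ≈-sym; trans to ≈-trans)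
  open Graph G using (adj-sym; adj-resp)

infixl 6 _∔_
_∔_ : Graph V → Graph V → Graph V
_∔_ {V} G H = record
  { Adj      = λ x y → (Adj G x y × ¬ Adj H x y) ⊎ (¬ Adj G x y × Adj H x y)
  ; adj-sym  = λ
      { (inj₁ (g , ¬h)) → inj₁ (G.adj-sym g , λ h → ¬h (H.adj-sym h))
      ; (inj₂ (¬g , h)) → inj₂ ((λ g → ¬g (G.adj-sym g)) , H.adj-sym h) }
  ; adj-irr  = λ
      { x≈y (inj₁ (g , _)) → G.adj-irr x≈y g
      ; x≈y (inj₂ (_ , h)) → H.adj-irr x≈y h }
  ; adj-resp =
      (λ { e (inj₁ (g , ¬h)) → inj₁ (proj₁ G.adj-resp e g , λ h → ¬h (proj₁ H.adj-resp (≈-sym e) h))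
         ; e (inj₂ (¬g , h)) → inj₂ ((λ g → ¬g (proj₁ G.adj-resp (≈-sym e) g)) , proj₁ H.adj-resp e h) })
    , (λ { e (inj₁ (g , ¬h)) → inj₁ (proj₂ G.adj-resp e g , λ h → ¬h (proj₂ H.adj-resp (≈-sym e) h))
         ; e (inj₂ (¬g , h)) → inj₂ ((λ g → ¬g (proj₂ G.adj-resp (≈-sym e) g)) , proj₂ H.adj-resp e h) })
  }
  where
  module G = Graph G
  module H = Graph H
  open Setoid V using () renaming (sym to ≈-sym)

SubsetSetoid : (V : Setoid 0ℓ 0ℓ) → Pred (Setoid.Carrier V) 0ℓ → Setoid 0ℓ 0ℓ
SubsetSetoid V A = record
  { Carrier       = Σ[ x ∈ V.Carrier ] x ∈ A
  ; _≈_           = λ p q → proj₁ p V.≈ proj₁ q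
  ; isEquivalence = record { refl = V.refl ; sym = V.sym ; trans = V.trans }
  }
  where module V = Setoid V

induced : (G : Graph V) (A : Pred (Setoid.Carrier V) 0ℓ) → Graph (SubsetSetoid V A)
induced G A = record
  { Adj      = λ p q → Adj G (proj₁ p) (proj₁ q)
  ; adj-sym  = adj-sym
  ; adj-irr  = adj-irr
  ; adj-resp = proj₁ adj-resp , proj₂ adj-resp
  }
  where open Graph G using (adj-sym; adj-irr; adj-resp)

InducedSubgraphOf : Graph W → Graph V → Set₁
InducedSubgraphOf {V = V} U H =
  Σ[ A ∈ Pred (Setoid.Carrier V) 0ℓ ] U ≅ induced H A

Bipartite : Graph V → Set
Bipartite {V} G = Σ[ c ∈ Func V (setoid Bool) ]
  (∀ {x y} → Adj G x y → Func.to c x ≢ Func.to c y)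

module _ {V : Setoid 0ℓ 0ℓ} where
  open Setoid V using (Carrier; _≈_)

  IsClique : Graph V → Pred Carrier 0ℓ → Set
  IsClique G A = ∀ {x y} → x ∈ A → y ∈ A → ¬ (x ≈ y) → Adj G x y

  IsIndependent : Graph V → Pred Carrier 0ℓ → Set
  IsIndependent G A = ∀ {x y} → x ∈ A → y ∈ A → ¬ Adj G x y

  Homogeneous : Graph V → Pred Carrier 0ℓ → Set
  Homogeneous G A = IsClique G A ⊎ IsIndependent G A

  Distinct₃ : Carrier → Carrier → Carrier → Set
  Distinct₃ x y z = ¬ (x ≈ y) × ¬ (x ≈ z) × ¬ (y ≈ z)

  ⟅_,_,_⟆ : Carrier → Carrier → Carrier → Pred Carrier 0ℓ
  ⟅ x , y , z ⟆ v = v ≈ x ⊎ v ≈ y ⊎ v ≈ z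

  SameHomogeneousTriples : Graph V → Graph V → Set
  SameHomogeneousTriples G H = ∀ x y z → Distinct₃ x y z →
    Homogeneous G ⟅ x , y , z ⟆ ⇔ Homogeneous H ⟅ x , y , z ⟆

-- An edge is an adjacent pair, taken up to exchange of its endpoints.
module _ {V : Setoid 0ℓ 0ℓ} (U : Graph V) where
  private
    module V = Setoid V
    open V using (Carrier; _≈_)

  record Edge : Set where
    constructor edge
    field
      end₁ end₂ : Carrier
      adjacent  : Adj U end₁ end₂

  -- Joins u x y  is  u = {x , y}.
  Joins : Edge → Carrier → Carrier → Set
  Joins (edge a b _) x y = (a ≈ x × b ≈ y) ⊎ (a ≈ y × b ≈ x)

  _≈ᵉ_ : Rel Edge 0ℓ
  u ≈ᵉ v = Joins u (Edge.end₁ v) (Edge.end₂ v)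

  private
    ≈ᵉ-sym : Symmetric _≈ᵉ_
    ≈ᵉ-sym (inj₁ (p , q)) = inj₁ (V.sym p , V.sym q)
    ≈ᵉ-sym (inj₂ (p , q)) = inj₂ (V.sym q , V.sym p)

    joins-resp : ∀ {u v x y} → u ≈ᵉ v → Joins v x y → Joins u x y
    joins-resp (inj₁ (p , q)) (inj₁ (r , s)) = inj₁ (V.trans p r , V.trans q s)
    joins-resp (inj₁ (p , q)) (inj₂ (r , s)) = inj₂ (V.trans p r , V.trans q s)
    joins-resp (inj₂ (p , q)) (inj₁ (r , s)) = inj₂ (V.trans p s , V.trans q r)
    joins-resp (inj₂ (p , q)) (inj₂ (r , s)) = inj₁ (V.trans p s , V.trans q r)

    joins-unique : ∀ {u x y z} → Joins u x y → Joins u x z → y ≈ z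
    joins-unique (inj₁ (p , q)) (inj₁ (r , s)) = V.trans (V.sym q) s
    joins-unique (inj₁ (p , q)) (inj₂ (r , s)) =
      V.trans (V.sym q) (V.trans s (V.trans (V.sym p) r))
    joins-unique (inj₂ (p , q)) (inj₁ (r , s)) =
      V.trans (V.sym p) (V.trans r (V.trans (V.sym q) s))
    joins-unique (inj₂ (p , q)) (inj₂ (r , s)) = V.trans (V.sym p) r

  EdgeSetoid : Setoid 0ℓ 0ℓ
  EdgeSetoid = record
    { Carrier       = Edge
    ; _≈_           = _≈ᵉ_
    ; isEquivalence = record
        { refl  = inj₁ (V.refl , V.refl)
        ; sym   = λ {u} {v} → ≈ᵉ-sym {u} {v}
        ; trans = λ {u} {v} {w} → joins-resp {u} {v}
        }
    }

  S : Graph EdgeSetoid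
  S = record
    { Adj      = λ u v → ∃[ x ] ∃[ y ] ∃[ z ] Distinct₃ {V} x y z
                   × Joins u x y × Joins v x z × ¬ Adj U y z
    ; adj-sym  = λ (x , y , z , (x≉y , x≉z , y≉z) , ju , jv , ¬yz) →
                   x , z , y , (x≉z , x≉y , λ z≈y → y≉z (V.sym z≈y)) , jv , ju
                   , λ zy → ¬yz (Graph.adj-sym U zy)
    ; adj-irr  = λ {u} {v} u≈v (x , y , z , (_ , _ , y≉z) , ju , jv , _) →
                   y≉z (joins-unique {u} ju (joins-resp {u} {v} u≈v jv))
    ; adj-resp = (λ {u} {v} {w} v≈w (x , y , z , d , ju , jv , ¬yz) →
                   x , y , z , d , ju , joins-resp {w} {v} (≈ᵉ-sym {v} {w} v≈w) jv , ¬yz)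
               , (λ {w} {u} {v} u≈v (x , y , z , d , ju , jw , ¬yz) →
                   x , y , z , d , joins-resp {v} {u} (≈ᵉ-sym {u} {v} u≈v) ju , jw , ¬yz)
    }

-- Star alone would only be reflexive up to _≡_.
Connected : (G : Graph V) → Rel (Setoid.Carrier V) 0ℓ
Connected {V} G = Star (Setoid._≈_ V ∪ Adj G)

component : (G : Graph V) (x : Setoid.Carrier V) → Graph (SubsetSetoid V (Connected G x))
component G x = induced G (Connected G x)

undirected : {A : Set} (_⟶_ : Rel A 0ℓ) → (∀ {x} → ¬ (x ⟶ x)) → Graph (setoid A)
undirected _⟶_ irr = record
  { Adj      = SymClosure _⟶_
  ; adj-sym  = Sym.symmetric _⟶_
  ; adj-irr  = λ { refl (fwd p) → irr p ; refl (bwd p) → irr p }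
  ; adj-resp = (λ { refl p → p }) , (λ { refl p → p })
  }

path : (n : ℕ) → Graph (setoid (Fin n))
path n = undirected (λ i j → suc (toℕ i) ≡ toℕ j) 1+n≢n

ray : Graph (setoid ℕ)
ray = undirected (λ i j → suc i ≡ j) 1+n≢n

doubleRay : Graph (setoid ℤ)
doubleRay = undirected (λ i j → ℤ.suc i ≡ j) (λ p → ℤₚ.i≢suc[i] (sym p))

cycle : (n : ℕ) → 3 ≤ n → Graph (setoid (Fin n))
cycle n 3≤n = undirected
  (λ i j → suc (toℕ i) ≡ toℕ j ⊎ (suc (toℕ i) ≡ n × toℕ j ≡ 0))
  (λ { (inj₁ p) → 1+n≢n p ; (inj₂ (p , q)) → n≢1 3≤n (trans (sym p) (cong suc q)) })
  where
  n≢1 : ∀ {n} → 3 ≤ n → n ≢ 1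
  n≢1 (s≤s ()) refl

IsEvenCycle : Graph V → Set
IsEvenCycle G = ∃[ n ] Σ[ 3≤n ∈ 3 ≤ n ] 2 ∣ n × G ≅ cycle n 3≤n

-- No finiteness is assumed, so a path may be infinite in one or both directions.
IsPath : Graph V → Set
IsPath G = (∃[ n ] G ≅ path (suc n)) ⊎ G ≅ ray ⊎ G ≅ doubleRay

IsIsolatedVertex : Graph V → Set
IsIsolatedVertex {V} G = ∃[ x ] ∀ y → y ≈ x
  where open Setoid V using (_≈_)

ComponentsAreEvenCyclesOrPaths : Graph V → Set
ComponentsAreEvenCyclesOrPaths G = ∀ x →
  IsEvenCycle (component G x) ⊎ IsPath (component G x) ⊎ IsIsolatedVertex (component G x)

P₉ : Graph (setoid (Fin 3 × Fin 3))
P₉ = record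
  { Adj      = λ (i , j) (k , l) → (i ≡ k × j ≢ l) ⊎ (i ≢ k × j ≡ l)
  ; adj-sym  = λ
      { (inj₁ (p , q)) → inj₁ (sym p , λ r → q (sym r))
      ; (inj₂ (p , q)) → inj₂ ((λ r → p (sym r)) , sym q) }
  ; adj-irr  = λ { refl (inj₁ (_ , q)) → q refl ; refl (inj₂ (p , _)) → p refl }
  ; adj-resp = (λ { refl p → p }) , (λ { refl p → p })
  }

{-# OPTIONS --safe #-}

-- All three properties are compared with the existence of a 2-colouring h of the pairs of
-- vertices such that h{x,y} ≠ h{x,z} whenever {x,y} and {x,z} are edges of U and {y,z} is not,
-- or the other way round: h is the graph G of (1), and it restricts to 2-colourings of S(U) and
-- S(complement U).
--
-- From (3) to h: if U is induced in P₉, colour by the parallel classes of the affine plane of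
-- order 3.  If the components of U are even cycles or paths, orient them and 2-colour the
-- vertices: an edge takes the colour of its tail, a non-edge the sum of the colours of its ends.
--
-- From h to (3): if U (or its complement) has no triangle, h is a proper 2-colouring of its
-- edges, and a component is the orbit of a vertex under the two involutions exchanging the ends
-- of the edges of one colour, that is a ray, a double ray, a finite path or an even cycle.  If U has a
-- triangle and three independent vertices, excluding claws and co-claws forces an induced bull;
-- embed it in P₉.  By a finite check, claws, co-claws and a cycle of length 9 leave four
-- possibilities for the neighbours of a further vertex in the bull, those of the four remaining
-- points of P₉, each of which occurs at most once.
module Submission where

open import Defs
open import Axiom.UniquenessOfIdentityProofs.WithK using (uip)
open import Data.Bool.Base using (Bool; true; false; not; _xor_; if_then_else_)
open import Data.Bool.Properties as Bool using (not-involutive; not-injective; ¬-not; not-¬)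
open import Data.Empty using (⊥; ⊥-elim)
open import Data.Fin.Base using (Fin; zero; suc; toℕ; fromℕ<)
open import Data.Fin.Patterns
open import Data.Fin.Properties as Fin using (all?; any?; toℕ-injective; toℕ<n; toℕ≤pred[n]; toℕ-fromℕ<)
open import Data.Fin.Subset.Properties using (anySubset?)
open import Data.Integer.Base as ℤ using (ℤ; +_; -[1+_])
open import Data.Integer.Properties as ℤ using ()
open import Data.Nat.Base using (ℕ; zero; suc; _≤_; _<_; s≤s; z≤n; _+_; _*_; _∸_)
open import Data.Nat.Divisibility using (_∣_; divides)
open import Data.Nat.DivMod using (_mod_)
open import Data.Nat.Induction using (<-rec)
open import Data.Nat.Properties as ℕ using (suc-injective)
open import Data.Product.Base using (Σ-syntax; ∃; ∃-syntax; _×_; _,_; proj₁; proj₂)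
open import Data.Product.Properties using (≡-dec)
open import Data.Sum.Base using (_⊎_; inj₁; inj₂)
open import Data.Vec.Base using (Vec; lookup; tabulate)
import Data.Vec.Functional as Vector
open import Data.Vec.Properties using (lookup∘tabulate)
open import Function.Base using (_∘_; id; case_of_)
open import Function.Bundles using (_⇔_; mk⇔; Equivalence; Func; Inverse)
open import Level using (0ℓ)
open import Relation.Binary.Bundles using (Setoid)
open import Relation.Binary.Construct.Closure.ReflexiveTransitive using (ε; _◅_; _◅◅_; reverse)
open import Relation.Binary.Construct.Closure.Symmetric using (SymClosure; fwd; bwd)
open import Relation.Binary.Core using (Rel)
open import Relation.Binary.Definitions using (tri<; tri≈; tri>)
open import Relation.Binary.PropositionalEquality
  using (_≡_; _≢_; refl; sym; trans; cong; cong₂; subst; subst₂; setoid)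
open import Relation.Nullary
  using (Dec; yes; no; does; ¬_; contradiction; _×-dec_; _⊎-dec_; _→-dec_; ¬?)
open import Relation.Nullary.Decidable
  using (dec-true; dec-false; decidable-stable; does-⇔; from-yes; from-no)

-- Homogeneous triples under Boolean sums

Mono : Bool → Bool → Bool → Set
Mono a b c = a ≡ b × a ≡ c

-- For the pairs `xy`, `xz`, `yz` of a triple, the `uᵢ` stand for adjacency in `U` and `a`, `b`, `c`
-- for adjacency in `G`. If the `uᵢ` agree, the sum keeps or negates all three entries. Otherwise
-- exactly two agree, the entries of `G` there differ before and after the sum, and neither side
-- holds.
mono-flip : ∀ u₁ u₂ u₃ a b c →
  (u₁ ≡ u₂ → u₃ ≢ u₁ → a ≢ b) → (u₁ ≡ u₃ → u₂ ≢ u₁ → a ≢ c) → (u₂ ≡ u₃ → u₁ ≢ u₂ → b ≢ c) →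
  Mono a b c ⇔ Mono (u₁ xor a) (u₂ xor b) (u₃ xor c)
mono-flip true  true  true  a b c _ _ _ = mk⇔ (λ { (refl , refl) → refl , refl })
  (λ (p , q) → not-injective p , not-injective q)
mono-flip false false false a b c _ _ _ = mk⇔ id id
mono-flip true  true  false a b c p _ _ = mk⇔ (λ (e , _) → ⊥-elim (p refl (λ ()) e))
  (λ (e , _) → ⊥-elim (p refl (λ ()) (not-injective e)))
mono-flip false false true  a b c p _ _ = mk⇔ (λ (e , _) → ⊥-elim (p refl (λ ()) e))
  (λ (e , _) → ⊥-elim (p refl (λ ()) e))
mono-flip true  false true  a b c _ p _ = mk⇔ (λ (_ , e) → ⊥-elim (p refl (λ ()) e))
  (λ (_ , e) → ⊥-elim (p refl (λ ()) (not-injective e)))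
mono-flip false true  false a b c _ p _ = mk⇔ (λ (_ , e) → ⊥-elim (p refl (λ ()) e))
  (λ (_ , e) → ⊥-elim (p refl (λ ()) e))
mono-flip false true  true  a b c _ _ p = mk⇔ (λ (d , e) → ⊥-elim (p refl (λ ()) (trans (sym d) e)))
  (λ (d , e) → ⊥-elim (p refl (λ ()) (not-injective (trans (sym d) e))))
mono-flip true  false false a b c _ _ p = mk⇔ (λ (d , e) → ⊥-elim (p refl (λ ()) (trans (sym d) e)))
  (λ (d , e) → ⊥-elim (p refl (λ ()) (trans (sym d) e)))

-- If `a ≡ b`, the first two entries agree on both sides, while the third joins them on exactly one
-- side because `v ≢ u`; the equivalence then fails.
mono-flip⁻¹ : ∀ u v a b c → Mono a b c ⇔ Mono (u xor a) (u xor b) (v xor c) → v ≢ u → a ≢ b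
mono-flip⁻¹ true  true  _     _ _     h n _    = n refl
mono-flip⁻¹ false false _     _ _     h n _    = n refl
mono-flip⁻¹ true  false true  _ true  h n refl = contradiction (proj₂ (Equivalence.to h (refl , refl))) λ ()
mono-flip⁻¹ true  false true  _ false h n refl = contradiction (proj₂ (Equivalence.from h (refl , refl))) λ ()
mono-flip⁻¹ true  false false _ true  h n refl = contradiction (proj₂ (Equivalence.from h (refl , refl))) λ ()
mono-flip⁻¹ true  false false _ false h n refl = contradiction (proj₂ (Equivalence.to h (refl , refl))) λ ()
mono-flip⁻¹ false true  true  _ true  h n refl = contradiction (proj₂ (Equivalence.to h (refl , refl))) λ ()
mono-flip⁻¹ false true  true  _ false h n refl = contradiction (proj₂ (Equivalence.from h (refl , refl))) λ ()
mono-flip⁻¹ false true  false _ true  h n refl = contradiction (proj₂ (Equivalence.from h (refl , refl))) λ ()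
mono-flip⁻¹ false true  false _ false h n refl = contradiction (proj₂ (Equivalence.to h (refl , refl))) λ ()

≢-≢⇒≡ : ∀ {a b c : Bool} → a ≢ b → b ≢ c → a ≡ c
≢-≢⇒≡ p q = trans (¬-not p) (sym (¬-not (λ e → q (sym e))))

-- Colouring from linear components

parity : ℕ → Bool
parity zero    = false
parity (suc n) = not (parity n)

parity-even : ∀ {n} → 2 ∣ n → parity n ≡ false
parity-even (divides q refl) = go q
  where
  go : ∀ q → parity (q * 2) ≡ false
  go zero    = refl
  go (suc q) = trans (not-involutive _) (go q)

not-≢ : ∀ {b} → b ≢ not b
not-≢ {true}  ()
not-≢ {false} ()

parity-≢ : ∀ {m n} → suc m ≡ n → parity m ≢ parity n
parity-≢ refl = not-≢

-- An orientation making every component a directed path or a directed cycle of even length.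
record Orientation {V : Setoid 0ℓ 0ℓ} (G : Graph V) : Set₁ where
  open Setoid V using (Carrier; _≈_)
  infix 4 _⟶_
  field
    _⟶_        : Rel Carrier 0ℓ
    ⟶-resp     : ∀ {x x′ y y′} → x ≈ x′ → y ≈ y′ → x ⟶ y → x′ ⟶ y′
    oriented   : ∀ {x y} → Adj G x y → x ⟶ y ⊎ y ⟶ x
    out-unique : ∀ {x y z} → x ⟶ y → x ⟶ z → y ≈ z
    in-unique  : ∀ {x y z} → y ⟶ x → z ⟶ x → y ≈ z
    ⟶-asym     : ∀ {x y} → x ⟶ y → ¬ y ⟶ x
    side       : Carrier → Bool
    side-cong  : ∀ {x y} → x ≈ y → side x ≡ side y
    side-≢     : ∀ {x y} → x ⟶ y → side x ≢ side y

module _ {V W : Setoid 0ℓ 0ℓ} {G : Graph V} {H : Graph W} where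

  orientation-≅ : G ≅ H → Orientation H → Orientation G
  orientation-≅ (f , G⇔H) O = record
    { _⟶_        = λ x y → to x ⟶ to y
    ; ⟶-resp     = λ p q → ⟶-resp (to-cong p) (to-cong q)
    ; oriented   = λ e → oriented (Equivalence.to (G⇔H _ _) e)
    ; out-unique = λ p q → to-injective (out-unique p q)
    ; in-unique  = λ p q → to-injective (in-unique p q)
    ; ⟶-asym     = ⟶-asym
    ; side       = side ∘ to
    ; side-cong  = side-cong ∘ to-cong
    ; side-≢     = side-≢
    }
    where
    open Orientation O
    open Inverse f
    module V = Setoid V
    module W = Setoid W
    to-injective : ∀ {x y} → to x W.≈ to y → x V.≈ y
    to-injective p = V.trans (V.sym (strictlyInverseʳ _)) (V.trans (from-cong p) (strictlyInverseʳ _))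

discrete-orientation : {I : Set} (H : Graph (setoid I)) (_⟶_ : Rel I 0ℓ) (side : I → Bool) →
  (∀ {i j} → Adj H i j → SymClosure _⟶_ i j) →
  (∀ {i j k} → i ⟶ j → i ⟶ k → j ≡ k) → (∀ {i j k} → j ⟶ i → k ⟶ i → j ≡ k) →
  (∀ {i j} → i ⟶ j → ¬ j ⟶ i) → (∀ {i j} → i ⟶ j → side i ≢ side j) →
  Orientation H
discrete-orientation H _⟶_ side arrows out in′ asym side-≢ = record
  { _⟶_ = _⟶_ ; ⟶-resp = λ { refl refl p → p }
  ; oriented = λ e → case arrows e of λ { (fwd p) → inj₁ p ; (bwd p) → inj₂ p }
  ; out-unique = out ; in-unique = in′ ; ⟶-asym = asym
  ; side = side ; side-cong = cong side ; side-≢ = side-≢ }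

2+n≢n : ∀ {n : ℕ} → suc (suc n) ≢ n
2+n≢n {suc n} e = 2+n≢n (suc-injective e)

ray-orientation : Orientation ray
ray-orientation = discrete-orientation ray _ parity id
  (λ { refl refl → refl }) (λ { refl e → sym (suc-injective e) }) (λ { refl e → 2+n≢n e })
  (λ { refl → not-≢ })

path-orientation : ∀ n → Orientation (path n)
path-orientation n = discrete-orientation (path n) _ (parity ∘ toℕ) id
  (λ p q → toℕ-injective (trans (sym p) q)) (λ p q → toℕ-injective (suc-injective (trans p (sym q))))
  (λ p q → 2+n≢n (trans (cong suc p) q)) parity-≢

doubleRay-orientation : Orientation doubleRay
doubleRay-orientation = discrete-orientation doubleRay _ sideℤ id
  (λ { refl refl → refl }) (λ p q → ℤ-suc-injective (trans p (sym q)))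
  (λ { refl q → asym _ q }) (λ { {i} refl → sideℤ-suc i })
  where
  sideℤ : ℤ → Bool
  sideℤ (+ n) = parity n
  sideℤ -[1+ n ] = not (parity n)
  sideℤ-suc : ∀ i → sideℤ i ≢ sideℤ (ℤ.suc i)
  sideℤ-suc (+ n) = not-≢
  sideℤ-suc -[1+ zero ] ()
  sideℤ-suc -[1+ suc n ] e = not-≢ (sym e)
  ℤ-suc-injective : ∀ {i j} → ℤ.suc i ≡ ℤ.suc j → i ≡ j
  ℤ-suc-injective {i} {j} e = trans (sym (ℤ.pred-suc i)) (trans (cong ℤ.pred e) (ℤ.pred-suc j))
  asym : ∀ i → ℤ.suc (ℤ.suc i) ≢ i
  asym i e = ℤ.<-irrefl (sym e) (ℤ.<-trans (ℤ.suc[i]≤j⇒i<j ℤ.≤-refl) (ℤ.suc[i]≤j⇒i<j ℤ.≤-refl))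

cycle-orientation : ∀ n 3≤n → 2 ∣ n → Orientation (cycle n 3≤n)
cycle-orientation n@(suc (suc (suc _))) 3≤n@(s≤s (s≤s (s≤s _))) 2∣n = discrete-orientation (cycle n 3≤n) _ (parity ∘ toℕ) id
  (λ { (inj₁ p) (inj₁ q) → toℕ-injective (trans (sym p) q)
     ; {k = k} (inj₁ p) (inj₂ (q , _)) → contradiction (trans (sym p) q) (ℕ.<⇒≢ (toℕ<n _))
     ; (inj₂ (p , _)) (inj₁ q) → contradiction (trans (sym q) p) (ℕ.<⇒≢ (toℕ<n _))
     ; (inj₂ (_ , p)) (inj₂ (_ , q)) → toℕ-injective (trans p (sym q)) })
  (λ { (inj₁ p) (inj₁ q) → toℕ-injective (suc-injective (trans p (sym q)))
     ; (inj₁ p) (inj₂ (_ , q)) → contradiction (trans p q) λ ()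
     ; (inj₂ (_ , p)) (inj₁ q) → contradiction (trans q p) λ ()
     ; (inj₂ (p , _)) (inj₂ (q , _)) → toℕ-injective (suc-injective (trans p (sym q))) })
  -- Opposite arrows involving the closing one would force `n` to be 1 or 2.
  (λ { (inj₁ p) (inj₁ q) → 2+n≢n (trans (cong suc p) q)
     ; (inj₁ p) (inj₂ (q , r)) → contradiction (trans (sym q) (cong suc (trans (sym p) (cong suc r)))) λ ()
     ; (inj₂ (p , q)) (inj₁ r) → contradiction (trans (sym p) (cong suc (trans (sym r) (cong suc q)))) λ ()
     ; (inj₂ (p , q)) (inj₂ (_ , r)) → contradiction (trans (sym p) (cong suc r)) λ () })
  (λ { (inj₁ p) → parity-≢ p
     -- The ends `n - 1` and `0` of the closing arrow lie on different sides because `n` is even.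
     ; {i} (inj₂ (p , q)) e → contradiction
         (trans (cong not (sym (trans e (cong parity q)))) (trans (cong parity p) (parity-even 2∣n))) λ () })

module _ {V : Setoid 0ℓ 0ℓ} (G : Graph V) where
  open Setoid V using (Carrier; _≈_) renaming (refl to ≈-refl; sym to ≈-sym; trans to ≈-trans)

  Connected-refl : ∀ {x y} → x ≈ y → Connected G x y
  Connected-refl p = inj₁ p ◅ ε

  Connected-sym : ∀ {x y} → Connected G x y → Connected G y x
  Connected-sym = reverse (λ { (inj₁ p) → inj₁ (≈-sym p) ; (inj₂ e) → inj₂ (Graph.adj-sym G e) })

  ComponentsOf : Setoid 0ℓ 0ℓ
  ComponentsOf = record
    { Carrier = Carrier ; _≈_ = Connected G
    ; isEquivalence = record { refl = ε ; sym = Connected-sym ; trans = _◅◅_ } }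

  module _ (choice : AxiomOfChoice) (O : ∀ x → Orientation (component G x)) where
    private
      module O x = Orientation (O x)
      rep = proj₁ (choice ComponentsOf)
      rep-≈ = proj₁ (proj₂ (choice ComponentsOf))
      rep-cong : ∀ {x y} → Connected G x y → rep x ≡ rep y
      rep-cong = proj₂ (proj₂ (choice ComponentsOf))

      -- The base point is a variable `b`, not `rep x`, so that vertices with equal representatives
      -- become elements of one and the same component.
      at : ∀ {b} x → rep x ≡ b → ∃ (Connected G b)
      at x refl = x , rep-≈ x

      at-proj₁ : ∀ {b} x (p : rep x ≡ b) → proj₁ (at x p) ≡ x
      at-proj₁ x refl = refl

      at-cong : ∀ {b} {x x′} (p : rep x ≡ b) (p′ : rep x′ ≡ b) → x ≈ x′ → proj₁ (at x p) ≈ proj₁ (at x′ p′)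
      at-cong {x = x} {x′} p p′ e = subst₂ _≈_ (sym (at-proj₁ x p)) (sym (at-proj₁ x′ p′)) e

      at-cancel : ∀ {b} {x x′} (p : rep x ≡ b) (p′ : rep x′ ≡ b) → proj₁ (at x p) ≈ proj₁ (at x′ p′) → x ≈ x′
      at-cancel {x = x} {x′} p p′ e = subst₂ _≈_ (at-proj₁ x p) (at-proj₁ x′ p′) e

      infix 4 _⟶_
      _⟶_ : Rel Carrier 0ℓ
      x ⟶ y = ∃[ b ] Σ[ p ∈ rep x ≡ b ] Σ[ q ∈ rep y ≡ b ] (O._⟶_ b (at x p) (at y q))

      side : Carrier → Bool
      side x = O.side (rep x) (at x refl)

      side-at : ∀ {b} x (p : rep x ≡ b) → side x ≡ O.side b (at x p)
      side-at x refl = refl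

    -- `O` may orient one component differently for different base points. Every vertex is therefore
    -- read in the component based at its representative, which connected vertices share.
    components-orientation : Orientation G
    components-orientation = record
      { _⟶_ = _⟶_
      ; ⟶-resp = λ {x} {x′} {y} {y′} e f (b , p , q , xy) →
          let p′ = trans (sym (rep-cong (Connected-refl e))) p
              q′ = trans (sym (rep-cong (Connected-refl f))) q
          in b , p′ , q′ , O.⟶-resp b (at-cong p p′ e) (at-cong q q′ f) xy
      ; oriented = λ {x} {y} e →
          let p = rep-cong (inj₂ e ◅ ε) in
          case O.oriented (rep y) {at x p} {at y refl} (subst (λ z → Adj G z y) (sym (at-proj₁ x p)) e) of λ
            { (inj₁ xy) → inj₁ (rep y , p , refl , xy)
            ; (inj₂ yx) → inj₂ (rep y , refl , p , yx) }
      ; out-unique = λ { (b , p , q , xy) (b′ , p′ , q′ , xz) → out p p′ q q′ xy xz }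
      ; in-unique = λ { (b , p , q , xy) (b′ , p′ , q′ , xz) → in′ p p′ q q′ xy xz }
      ; ⟶-asym = λ { (b , p , q , xy) (b′ , p′ , q′ , yx) → asym p q′ q p′ xy yx }
      ; side = side
      ; side-cong = λ {x} {y} e → let p = rep-cong (Connected-refl e) in
          trans (side-at x p) (O.side-cong (rep y) {at x p} {at y refl} (at-cong p refl e))
      ; side-≢ = λ {x} {y} (b , p , q , xy) e →
          O.side-≢ b xy (trans (sym (side-at x p)) (trans e (side-at y q)))
      }
      where
      out : ∀ {b b′ x y z} (p : rep x ≡ b) (p′ : rep x ≡ b′) (q : rep y ≡ b) (q′ : rep z ≡ b′) →
        O._⟶_ b (at x p) (at y q) → O._⟶_ b′ (at x p′) (at z q′) → y ≈ z
      out {b} refl refl q q′ xy xz = at-cancel q q′ (O.out-unique b xy xz)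
      in′ : ∀ {b b′ x y z} (p : rep y ≡ b) (p′ : rep z ≡ b′) (q : rep x ≡ b) (q′ : rep x ≡ b′) →
        O._⟶_ b (at y p) (at x q) → O._⟶_ b′ (at z p′) (at x q′) → y ≈ z
      in′ {b} p p′ refl refl xy xz = at-cancel p p′ (O.in-unique b xy xz)
      asym : ∀ {b b′ x y} (p : rep x ≡ b) (p′ : rep x ≡ b′) (q : rep y ≡ b) (q′ : rep y ≡ b′) →
        O._⟶_ b (at x p) (at y q) → ¬ O._⟶_ b′ (at y q′) (at x p′)
      asym {b} {x = x} {y} p refl q q′ xy yx with refl ← p =
        -- `q` and `q′` may be different proofs of one equation; `⟶-resp` passes between the two
        -- resulting copies of `y`.
        O.⟶-asym b xy (O.⟶-resp b {at y q′} {at y q} {at x refl} {at x refl} (at-cong q′ q ≈-refl) ≈-refl yx)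

-- Bulls in P₉

Point : Set
Point = Fin 3 × Fin 3

adj₉ : Point → Point → Bool
adj₉ (i , j) (k , l) = does (i Fin.≟ k) xor does (j Fin.≟ l)

Matrix : ℕ → Set
Matrix n = Fin n → Fin n → Bool

extend : ∀ {n} → (Fin n → Bool) → Matrix n → Matrix (suc n)
extend t M zero    zero    = false
extend t M zero    (suc j) = t j
extend t M (suc i) zero    = t i
extend t M (suc i) (suc j) = M i j

module _ {n : ℕ} (M : Matrix n) where

  -- The situation in which an alternating colouring must give the pairs `xy` and `xz` different
  -- colours.
  Step : Fin n → Fin n → Fin n → Set
  Step x y z = (x ≢ y × x ≢ z × y ≢ z) × M x y ≡ M x z × M y z ≢ M x y

  step? : ∀ x y z → Dec (Step x y z)
  step? x y z = (¬? (x Fin.≟ y) ×-dec ¬? (x Fin.≟ z) ×-dec ¬? (y Fin.≟ z))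
    ×-dec (M x y Bool.≟ M x z) ×-dec ¬? (M y z Bool.≟ M x y)

  -- A claw, or the complement of one.
  Claw : Set
  Claw = ∃[ x ] ∃[ a ] ∃[ b ] Step x a b × ∃[ c ] Step x a c × Step x b c

  claw? : Dec Claw
  claw? = any? λ x → any? λ a → any? λ b → step? x a b ×-dec any? λ c → step? x a c ×-dec step? x b c

  -- The triangle abc with pendant edges av, bd and ce, or the complement of this graph.
  -- Neither of them contains a claw or a co-claw, but the non-edges of the first one, in the
  -- order below, form a cycle of length 9 in the edge-graph of its complement.
  Net : Fin n → Fin n → Fin n → Fin n → Fin n → Fin n → Set
  Net v a b c d e = Step v d b × Step v b c × Step v c e × Step e v a × Step e a b ×
    Step e b d × Step d e c × Step d c a × Step d a v

  net? : ∀ v a b c d e → Dec (Net v a b c d e)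
  net? v a b c d e = step? v d b ×-dec step? v b c ×-dec step? v c e ×-dec step? e v a ×-dec
    step? e a b ×-dec step? e b d ×-dec step? d e c ×-dec step? d c a ×-dec step? d a v

-- The triangle a = (0,0), b = (0,1), c = (0,2) of P₉ with its neighbours d = (1,1) of b and
-- e = (2,2) of c.
bullPoint : Fin 5 → Point
bullPoint 0F = 0F , 0F
bullPoint 1F = 0F , 1F
bullPoint 2F = 0F , 2F
bullPoint 3F = 1F , 1F
bullPoint 4F = 2F , 2F

outerPoint : Fin 4 → Point
outerPoint 0F = 1F , 0F
outerPoint 1F = 1F , 2F
outerPoint 2F = 2F , 0F
outerPoint 3F = 2F , 1F

bull : Matrix 5
bull i j = adj₉ (bullPoint i) (bullPoint j)

outerType : Fin 4 → Fin 5 → Bool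
outerType k i = adj₉ (outerPoint k) (bullPoint i)

-- In `M` the new vertex is 0 and `a` to `e` are 1 to 5. The bull is self-complementary: in the
-- complement `ade` is a triangle with pendant edges `dc` and `eb`, and the second `Net` is the
-- first one relabelled accordingly.
bull-extension : ∀ (t : Vec Bool 5) → let M = extend (lookup t) bull in
  (∃[ k ] ∀ i → lookup t i ≡ outerType k i) ⊎ Claw M ⊎ Net M 0F 1F 2F 3F 4F 5F ⊎ Net M 0F 1F 4F 5F 3F 2F
-- `Vec Bool 5` is the type of subsets of a five-element set, so a counterexample can be searched
-- for among its 32 elements.
bull-extension t = decidable-stable (extension? t) λ n → from-no (anySubset? (λ t → ¬? (extension? t))) (t , n)
  where
  extension? : ∀ (t : Vec Bool 5) → let M = extend (lookup t) bull in Dec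
    ((∃[ k ] ∀ i → lookup t i ≡ outerType k i) ⊎ Claw M ⊎ Net M 0F 1F 2F 3F 4F 5F ⊎ Net M 0F 1F 4F 5F 3F 2F)
  extension? t = let M = extend (lookup t) bull in
    any? (λ k → all? λ i → lookup t i Bool.≟ outerType k i)
    ⊎-dec claw? M ⊎-dec net? M 0F 1F 2F 3F 4F 5F ⊎-dec net? M 0F 1F 4F 5F 3F 2F

-- The vertex of type `l` is added first, then the one of type `k`; `s` is their adjacency. The
-- first alternative says that they fit at two distinct outer points of P₉.
bull-extension₂ : ∀ s k l → (k ≢ l × s ≡ adj₉ (outerPoint k) (outerPoint l)) ⊎
  Claw (extend (s Vector.∷ outerType k) (extend (outerType l) bull))
bull-extension₂ s k l = go s k l
  where
  extension? : ∀ s k l → Dec ((k ≢ l × s ≡ adj₉ (outerPoint k) (outerPoint l)) ⊎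
    Claw (extend (s Vector.∷ outerType k) (extend (outerType l) bull)))
  extension? s k l = (¬? (k Fin.≟ l) ×-dec (s Bool.≟ _)) ⊎-dec claw? _
  go : ∀ s k l → (k ≢ l × s ≡ adj₉ (outerPoint k) (outerPoint l)) ⊎
    Claw (extend (s Vector.∷ outerType k) (extend (outerType l) bull))
  go true  = from-yes (all? λ k → all? λ l → extension? true k l)
  go false = from-yes (all? λ k → all? λ l → extension? false k l)

≟-comm : ∀ {n} (i j : Fin n) → does (i Fin.≟ j) ≡ does (j Fin.≟ i)
≟-comm i j = does-⇔ (mk⇔ sym sym) (i Fin.≟ j) (j Fin.≟ i)

adj₉-comm : ∀ p q → adj₉ p q ≡ adj₉ q p
adj₉-comm (i , j) (k , l) = cong₂ _xor_ (≟-comm i k) (≟-comm j l)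

P₉⇒adj₉ : ∀ {p q} → Adj P₉ p q → adj₉ p q ≡ true
P₉⇒adj₉ {i , j} {k , l} (inj₁ (p , q)) rewrite dec-true (i Fin.≟ k) p | dec-false (j Fin.≟ l) q = refl
P₉⇒adj₉ {i , j} {k , l} (inj₂ (p , q)) rewrite dec-false (i Fin.≟ k) p | dec-true (j Fin.≟ l) q = refl

adj₉⇒P₉ : ∀ {p q} → adj₉ p q ≡ true → Adj P₉ p q
adj₉⇒P₉ {i , j} {k , l} e with i Fin.≟ k | j Fin.≟ l
... | yes p | no q  = inj₁ (p , q)
... | no p  | yes q = inj₂ (p , q)
adj₉⇒P₉ () | yes _ | yes _
adj₉⇒P₉ () | no _  | no _

point? : (p q : Point) → Dec (p ≡ q)
point? = ≡-dec Fin._≟_ Fin._≟_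
  where open import Data.Product.Properties using (≡-dec)

bullPoint-injective : ∀ i j → bullPoint i ≡ bullPoint j → i ≡ j
bullPoint-injective = from-yes (all? λ i → all? λ j → point? (bullPoint i) (bullPoint j) →-dec (i Fin.≟ j))

outerPoint-injective : ∀ k l → outerPoint k ≡ outerPoint l → k ≡ l
outerPoint-injective = from-yes (all? λ k → all? λ l → point? (outerPoint k) (outerPoint l) →-dec (k Fin.≟ l))

bullPoint≢outerPoint : ∀ i k → bullPoint i ≢ outerPoint k
bullPoint≢outerPoint = from-yes (all? λ i → all? λ k → ¬? (point? (bullPoint i) (outerPoint k)))

-- Distinct non-adjacent points agree in exactly one of `i + j` and `i - j` modulo 3; the fibres of
-- `diagonal` are the lines of the first class.
diagonal : Point → Fin 3
diagonal (i , j) = (toℕ i + toℕ j) mod 3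

-- The affine plane of order 3 has four classes of parallel lines: the edges of P₉ are coloured
-- by two of them, the non-edges by the other two.
colour₉ : Point → Point → Bool
colour₉ p q = if adj₉ p q then does (proj₁ p Fin.≟ proj₁ q) else does (diagonal p Fin.≟ diagonal q)

colour₉-comm : ∀ p q → colour₉ p q ≡ colour₉ q p
colour₉-comm p q rewrite adj₉-comm p q = cong₂ (if adj₉ q p then_else_)
  (≟-comm (proj₁ p) (proj₁ q)) (≟-comm (diagonal p) (diagonal q))

-- If `pq` and `pr` had the same colour they would belong to one parallel class, so `p`, `q`, `r`
-- would be on one line and `qr` would be of the same kind. The proof runs through all triples.
colour₉-alternates : ∀ {p q r} → p ≢ q → p ≢ r → q ≢ r →
  adj₉ p q ≡ adj₉ p r → adj₉ q r ≢ adj₉ p q → colour₉ p q ≢ colour₉ p r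
colour₉-alternates {p₁ , p₂} {q₁ , q₂} {r₁ , r₂} = check p₁ p₂ q₁ q₂ r₁ r₂
  where
  check : ∀ p₁ p₂ q₁ q₂ r₁ r₂ → let p = p₁ , p₂ ; q = q₁ , q₂ ; r = r₁ , r₂ in
    p ≢ q → p ≢ r → q ≢ r → adj₉ p q ≡ adj₉ p r → adj₉ q r ≢ adj₉ p q → colour₉ p q ≢ colour₉ p r
  check = from-yes (all? λ p₁ → all? λ p₂ → all? λ q₁ → all? λ q₂ → all? λ r₁ → all? λ r₂ →
    let p = p₁ , p₂ ; q = q₁ , q₂ ; r = r₁ , r₂ in
    ¬? (point? p q) →-dec ¬? (point? p r) →-dec ¬? (point? q r) →-dec
    (adj₉ p q Bool.≟ adj₉ p r) →-dec ¬? (adj₉ q r Bool.≟ adj₉ p q) →-dec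
    ¬? (colour₉ p q Bool.≟ colour₉ p r))

-- Alternating words in two involutions

even-parity : ∀ n → parity n ≡ false → 2 ∣ n
even-parity zero _ = divides 0 refl
even-parity (suc (suc n)) e with even-parity n (trans (sym (not-involutive _)) e)
... | divides q refl = divides (suc q) refl

module Walk {X : Set} (σ : Bool → X → X) (σ-involutive : ∀ c x → σ c (σ c x) ≡ x) where

  letter : Bool → ℕ → Bool
  letter c zero    = c
  letter c (suc n) = not (letter c n)

  -- Two involutions generate an image of the infinite dihedral group, so the orbit of `x` consists
  -- of the alternating words applied to `x`; here `c` is the letter applied first.
  walk : Bool → ℕ → X → X
  walk c zero    x = x
  walk c (suc n) x = σ (letter c n) (walk c n x)

  letter-+ : ∀ c d i → letter c (d + i) ≡ parity d xor letter c i
  letter-+ c zero    i = refl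
  letter-+ c (suc d) i = trans (cong not (letter-+ c d i)) (Bool.not-distribˡ-xor (parity d) (letter c i))

  letter-parity : ∀ c n → letter c n ≡ parity n xor c
  letter-parity c n = trans (cong (letter c) (sym (ℕ.+-identityʳ n))) (letter-+ c n 0)

  letter-letter : ∀ c i d → letter (letter c i) d ≡ letter c (d + i)
  letter-letter c i zero    = refl
  letter-letter c i (suc d) = cong not (letter-letter c i d)

  walk-+ : ∀ c d i x → walk c (d + i) x ≡ walk (letter c i) d (walk c i x)
  walk-+ c zero    i x = refl
  walk-+ c (suc d) i x = cong₂ σ (sym (letter-letter c i d)) (walk-+ c d i x)

  walk-suc : ∀ c n x → walk c (suc n) x ≡ walk (not c) n (σ c x)
  walk-suc c n x = trans (cong (λ m → walk c m x) (ℕ.+-comm 1 n)) (walk-+ c n 1 x)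

  step-back : ∀ c n x → σ (letter c n) (walk c (suc n) x) ≡ walk c n x
  step-back c n x = σ-involutive (letter c n) (walk c n x)

  -- The word read backwards starts with the last letter of the walk, and the letters cancel one by
  -- one.
  walk-back : ∀ c n x → walk (letter c n) (suc n) (walk c (suc n) x) ≡ x
  walk-back c n x = trans (walk-suc (letter c n) n (walk c (suc n) x))
    (trans (cong (walk (not (letter c n)) n) (step-back c n x)) (rest n))
    where
    rest : ∀ n → walk (not (letter c n)) n (walk c n x) ≡ x
    rest zero    = refl
    rest (suc n) = trans (cong (λ l → walk l (suc n) (walk c (suc n) x)) (not-involutive (letter c n)))
      (walk-back c n x)

  module _ (c : Bool) (x : X) where
    private
      w : ℕ → X
      w n = walk c n x

    -- The word from `w i` to `w (d + i)` has odd length, so it begins and ends with the same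
    -- letter. Applying this letter at both places shortens the gap by two, until a single letter is
    -- left.
    odd-collision : ∀ d i → parity d ≡ true → w i ≡ w (d + i) → ∃[ k ] k < d + i × w k ≡ w (suc k)
    odd-collision (suc zero) i _ e = i , ℕ.≤-refl , e
    odd-collision (suc (suc d)) i odd e =
      let k , k< , stop = odd-collision d (suc i) odd′ e′
      in k , ℕ.<-trans (subst (k <_) (ℕ.+-suc d i) k<) ℕ.≤-refl , stop
      where
      odd′ : parity d ≡ true
      odd′ = trans (sym (not-involutive _)) odd
      e′ : w (suc i) ≡ w (d + suc i)
      e′ = trans (cong₂ σ (sym (trans (letter-+ c (suc d) i) (cong (λ b → not b xor letter c i) odd′))) e)
           (trans (step-back c (suc d + i) x) (cong w (sym (ℕ.+-suc d i))))

    -- The letters leading to `w i` and to `w (d + i)` are equal, so both walks can be undone in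
    -- parallel until the first is back at `x`.
    even-collision : ∀ d i → parity d ≡ false → w i ≡ w (d + i) → w 0 ≡ w d
    even-collision d zero    _    e = trans e (cong w (ℕ.+-identityʳ d))
    even-collision d (suc i) even e = even-collision d i even
      (trans (sym (step-back c i x)) (trans (cong₂ σ l (trans e (cong w (ℕ.+-suc d i)))) (step-back c (d + i) x)))
      where
      l : letter c i ≡ letter c (d + i)
      l = sym (trans (letter-+ c d i) (cong (_xor letter c i) even))

    module _ (n : ℕ) (no-stop : ∀ {k} → k < n → w k ≢ w (suc k))
             (no-return : ∀ {d} → d < n → parity (suc d) ≡ false → w 0 ≢ w (suc d)) where

      private
        no-collision : ∀ {i} d → suc d + i ≤ n → w i ≢ w (suc d + i)
        no-collision {i} d d+i≤n e with parity (suc d) in p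
        ... | true  = let k , k< , stop = odd-collision (suc d) i p e
                      in no-stop (ℕ.<-≤-trans k< d+i≤n) stop
        ... | false = no-return (ℕ.≤-trans (ℕ.m≤m+n (suc d) i) d+i≤n) p (even-collision (suc d) i p e)

        no-collision-< : ∀ {i j} → i < j → j ≤ n → w i ≢ w j
        no-collision-< {i} {j} i<j j≤n e = no-collision (j ∸ suc i) (subst (_≤ n) (sym j≡) j≤n) (trans e (cong w (sym j≡)))
          where
          j≡ : suc (j ∸ suc i) + i ≡ j
          j≡ = trans (sym (ℕ.+-suc (j ∸ suc i) i)) (ℕ.m∸n+n≡m i<j)

      -- Two equal terms at an odd distance produce a stop, at an even distance a return to `x`;
      -- both are excluded up to time `n`.
      walk-injective : ∀ {i j} → i ≤ n → j ≤ n → w i ≡ w j → i ≡ j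
      walk-injective {i} {j} i≤n j≤n e with ℕ.<-cmp i j
      ... | tri< i<j _ _ = ⊥-elim (no-collision-< i<j j≤n e)
      ... | tri≈ _ i≡j _ = i≡j
      ... | tri> _ _ j<i = ⊥-elim (no-collision-< j<i i≤n (sym e))

    -- The last letter of a word of even length is `not c`, which fixes `x`; so a walk that returns
    -- was already at `x` one step before.
    bounce : σ (not c) x ≡ x → ∀ {d} → parity (suc d) ≡ false → w 0 ≡ w (suc d) → w d ≡ w (suc d)
    bounce start {d} even e = trans (sym (step-back c d x))
      (trans (cong₂ σ l (sym e)) (trans start e))
      where
      l : letter c d ≡ not c
      l = trans (letter-parity c d) (cong (_xor c) (not-injective even))

    -- Either letter moves `w n` one step along the walk, except `not c` at the starting point,
    -- whose effect is left open.
    data Move (d : Bool) : ℕ → Set where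
      onward : ∀ {n} → σ d (w n) ≡ w (suc n) → Move d n
      start  : d ≡ not c → Move d zero
      back   : ∀ {n} → σ d (w (suc n)) ≡ w n → Move d (suc n)

    move : ∀ d n → Move d n
    move d n with d Bool.≟ letter c n
    move d n       | yes refl = onward refl
    move d zero    | no d≢    = start (¬-not d≢)
    move d (suc n) | no d≢    = back (trans
      (cong (λ l → σ l (w (suc n))) (trans (¬-not d≢) (not-involutive (letter c n)))) (step-back c n x))

  module _ (c : Bool) (x : X) where

    -- The orbit of `x` laid out along the integers: words beginning with `c` to the right, words
    -- beginning with `not c` to the left.
    zigzag : ℤ → X
    zigzag (+ n)    = walk c n x
    zigzag -[1+ n ] = walk (not c) (suc n) x

    zigzag-suc : ∀ i → ∃[ d ] σ d (zigzag i) ≡ zigzag (ℤ.suc i)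
    zigzag-suc (+ n)        = letter c n , refl
    zigzag-suc -[1+ zero ]  = not c , step-back (not c) 0 x
    zigzag-suc -[1+ suc n ] = letter (not c) (suc n) , step-back (not c) (suc n) x

    zigzag-move : ∀ d i → σ d (zigzag i) ≡ zigzag (ℤ.suc i) ⊎ (∃[ j ] ℤ.suc j ≡ i × σ d (zigzag i) ≡ zigzag j)
    zigzag-move d (+ n) with move c x d n
    ... | onward e = inj₁ e
    ... | start refl = inj₂ (-[1+ 0 ] , refl , refl)
    ... | back {m} e = inj₂ (+ m , refl , e)
    zigzag-move d -[1+ n ] with move (not c) x d (suc n)
    -- On the negative half the walk runs to the left, so going onward lowers the index and going
    -- back raises it.
    ... | onward e = inj₂ (-[1+ suc n ] , refl , e)
    zigzag-move d -[1+ zero ]  | back e = inj₁ e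
    zigzag-move d -[1+ suc n ] | back e = inj₁ e

    module _ (no-return : ∀ y d n → (∃[ i ] zigzag i ≡ y) → walk d (suc n) y ≢ y) where

      private
        no-collision : ∀ d → (∀ n → ∃[ i ] zigzag i ≡ walk d n x) → ∀ {i j} → i < j → walk d i x ≢ walk d j x
        no-collision d on {i} {j} i<j e = no-return (walk d i x) (letter d i) (j ∸ suc i) (on i)
          (trans (sym (walk-+ d (suc (j ∸ suc i)) i x)) (trans (cong (λ m → walk d m x) j≡) (sym e)))
          where
          j≡ : suc (j ∸ suc i) + i ≡ j
          j≡ = trans (sym (ℕ.+-suc (j ∸ suc i) i)) (ℕ.m∸n+n≡m i<j)

        inj : ∀ d → (∀ n → ∃[ i ] zigzag i ≡ walk d n x) → ∀ {i j} → walk d i x ≡ walk d j x → i ≡ j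
        inj d on {i} {j} e with ℕ.<-cmp i j
        ... | tri< i<j _ _ = ⊥-elim (no-collision d on i<j e)
        ... | tri≈ _ i≡j _ = i≡j
        ... | tri> _ _ j<i = ⊥-elim (no-collision d on j<i (sym e))

        on₊ : ∀ n → ∃[ i ] zigzag i ≡ walk c n x
        on₊ n = + n , refl

        on₋ : ∀ n → ∃[ i ] zigzag i ≡ walk (not c) n x
        on₋ zero    = + 0 , refl
        on₋ (suc n) = -[1+ n ] , refl

        -- The way from the negative point back to `x`, continued to the nonnegative one, is a
        -- single alternating word, which a collision would close.
        opposite : ∀ i j → zigzag (+ i) ≢ zigzag -[1+ j ]
        opposite i j e = no-return y (letter (not c) j) (i + j) (-[1+ j ] , refl)
          (trans (cong (λ m → walk (letter (not c) j) m y) (sym (ℕ.+-suc i j)))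
          (trans (walk-+ (letter (not c) j) i (suc j) y)
          (trans (cong₂ (λ d → walk d i) turn (walk-back (not c) j x)) e)))
          where
          y : X
          y = zigzag -[1+ j ]
          -- The last letter on the way back to `x` is `not c`, so the alternation continues with
          -- `c`.
          turn : letter (letter (not c) j) (suc j) ≡ c
          turn rewrite letter-parity (letter (not c) j) j | letter-parity (not c) j with parity j
          ... | true  = trans (not-involutive _) (not-involutive c)
          ... | false = not-involutive c

      zigzag-injective : ∀ {i j} → zigzag i ≡ zigzag j → i ≡ j
      zigzag-injective {+ i}      {+ j}      e = cong +_ (inj c on₊ e)
      zigzag-injective {+ i}      { -[1+ j ]} e = ⊥-elim (opposite i j e)
      zigzag-injective { -[1+ i ]} {+ j}      e = ⊥-elim (opposite j i (sym e))
      zigzag-injective { -[1+ i ]} { -[1+ j ]} e = cong -[1+_] (suc-injective (inj (not c) on₋ e))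

-- Alternating colourings and properties (1) and (2)

module Classical (choice : AxiomOfChoice) where

  abstract
    -- Diaconescu's argument: `true` and `false` are identified exactly when `P` holds, and whether
    -- their representatives coincide is decidable.
    em : (P : Set) → Dec P
    em P = decide (rep true Bool.≟ rep false)
      where
      Bool/P : Setoid 0ℓ 0ℓ
      Bool/P = record
        { Carrier = Bool
        ; _≈_ = λ b c → b ≡ c ⊎ P
        ; isEquivalence = record
            { refl = inj₁ refl
            ; sym = λ { (inj₁ e) → inj₁ (sym e) ; (inj₂ p) → inj₂ p }
            ; trans = λ { (inj₁ e) (inj₁ f) → inj₁ (trans e f) ; (inj₂ p) _ → inj₂ p ; _ (inj₂ p) → inj₂ p }
            }
        }
      rep : Bool → Bool
      rep = proj₁ (choice Bool/P)
      rep-≈ : ∀ b → rep b ≡ b ⊎ P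
      rep-≈ = proj₁ (proj₂ (choice Bool/P))
      rep-cong : ∀ {b c} → b ≡ c ⊎ P → rep b ≡ rep c
      rep-cong = proj₂ (proj₂ (choice Bool/P))
      decide : Dec (rep true ≡ rep false) → Dec P
      decide (no ne) = no (λ p → ne (rep-cong (inj₂ p)))
      decide (yes e) with rep true | rep false | e | rep-≈ true | rep-≈ false
      ... | _     | _     | _    | inj₂ p    | _         = yes p
      ... | _     | _     | _    | inj₁ _    | inj₂ p    = yes p
      ... | true  | false | ()   | inj₁ refl | inj₁ refl

  ¬¬-elim : {P : Set} → ¬ ¬ P → P
  ¬¬-elim {P} = decidable-stable (em P)

  ⌊_⌋ : Set → Bool
  ⌊ P ⌋ = does (em P)

  ⌊⌋-true : ∀ {P} → P → ⌊ P ⌋ ≡ true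
  ⌊⌋-true {P} = dec-true (em P)

  ⌊⌋-false : ∀ {P} → ¬ P → ⌊ P ⌋ ≡ false
  ⌊⌋-false {P} = dec-false (em P)

  true-⌊⌋ : ∀ {P} → ⌊ P ⌋ ≡ true → P
  true-⌊⌋ {P} with em P
  ... | yes p = λ _ → p
  ... | no _ = λ ()

  false-⌊⌋ : ∀ {P} → ⌊ P ⌋ ≡ false → ¬ P
  false-⌊⌋ {P} with em P
  ... | yes p = λ ()
  ... | no ¬p = λ _ → ¬p

  ⌊⌋-cong : ∀ {P Q} → (P → Q) → (Q → P) → ⌊ P ⌋ ≡ ⌊ Q ⌋
  ⌊⌋-cong {P} {Q} f g with em P
  ... | yes p = sym (⌊⌋-true (f p))
  ... | no ¬p = sym (⌊⌋-false (λ q → ¬p (g q)))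

  ⌊≡true⌋ : ∀ b → ⌊ b ≡ true ⌋ ≡ b
  ⌊≡true⌋ true  = ⌊⌋-true refl
  ⌊≡true⌋ false = ⌊⌋-false λ ()

  module _ {V : Setoid 0ℓ 0ℓ} where
    open Setoid V using (Carrier; _≈_) renaming (refl to ≈-refl; sym to ≈-sym; trans to ≈-trans)

    module _ (G : Graph V) where

      adj : Carrier → Carrier → Bool
      adj x y = ⌊ Adj G x y ⌋

      adj-comm : ∀ x y → adj x y ≡ adj y x
      adj-comm x y = ⌊⌋-cong (Graph.adj-sym G) (Graph.adj-sym G)

      Adj-cong : ∀ {x x′ y y′} → x ≈ x′ → y ≈ y′ → Adj G x y → Adj G x′ y′
      Adj-cong p q e = proj₁ (Graph.adj-resp G) q (proj₂ (Graph.adj-resp G) p e)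

      adj-cong : ∀ {x x′ y y′} → x ≈ x′ → y ≈ y′ → adj x y ≡ adj x′ y′
      adj-cong p q = ⌊⌋-cong (Adj-cong p q) (Adj-cong (≈-sym p) (≈-sym q))

      adj-complement : ∀ {x y} → ¬ x ≈ y → ⌊ Adj (complement G) x y ⌋ ≡ not (adj x y)
      adj-complement {x} {y} x≉y with em (Adj G x y)
      ... | yes e = ⌊⌋-false (λ (_ , ¬e) → ¬e e)
      ... | no ¬e = ⌊⌋-true (x≉y , ¬e)

      complement-involutive : ∀ {x y} → Adj (complement (complement G)) x y ⇔ Adj G x y
      complement-involutive = mk⇔ (λ (x≉y , ¬ne) → ¬¬-elim (λ ¬e → ¬ne (x≉y , ¬e)))
        (λ e → (λ x≈y → Graph.adj-irr G x≈y e) , (λ (_ , ¬e) → ¬e e))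

      -- For G = U, colour is the first graph of property (1); its restrictions to the edges and
      -- to the non-edges of U are 2-colourings of S(U) and S(complement U).
      record Alternating : Set where
        field
          colour      : Carrier → Carrier → Bool
          colour-comm : ∀ x y → colour x y ≡ colour y x
          colour-cong : ∀ {x x′ y y′} → x ≈ x′ → y ≈ y′ → colour x y ≡ colour x′ y′
          alternates  : ∀ {x y z} → Distinct₃ {V} x y z →
                        adj x y ≡ adj x z → adj y z ≢ adj x y → colour x y ≢ colour x z

      -- A 2-colouring of `S G`, as a function on pairs of vertices instead of edges carrying a
      -- proof of adjacency.
      record EdgeColouring : Set where
        field
          colour      : Carrier → Carrier → Bool
          colour-comm : ∀ x y → colour x y ≡ colour y x
          colour-cong : ∀ {x x′ y y′} → x ≈ x′ → y ≈ y′ → colour x y ≡ colour x′ y′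
          proper      : ∀ {x y z} → Distinct₃ {V} x y z →
                        Adj G x y → Adj G x z → ¬ Adj G y z → colour x y ≢ colour x z

    distinct₂₁₃ : ∀ {x y z} → Distinct₃ {V} x y z → Distinct₃ {V} y x z
    distinct₂₁₃ (p , q , r) = p ∘ ≈-sym , r , q

    distinct₃₁₂ : ∀ {x y z} → Distinct₃ {V} x y z → Distinct₃ {V} z x y
    distinct₃₁₂ (p , q , r) = q ∘ ≈-sym , r ∘ ≈-sym , p

    -- The condition only compares adjacencies with each other, so it survives the negation of all
    -- of them.
    complement-alternating : ∀ {G} → Alternating G → Alternating (complement G)
    complement-alternating {G} A = record
      { colour = colour ; colour-comm = colour-comm ; colour-cong = colour-cong
      ; alternates = λ {x} {y} {z} d@(x≉y , x≉z , y≉z) e n → alternates d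
          (not-injective (trans (sym (adj-complement G x≉y)) (trans e (adj-complement G x≉z))))
          (λ e′ → n (trans (adj-complement G y≉z) (trans (cong not e′) (sym (adj-complement G x≉y)))))
      }
      where open Alternating A

    alternating-cong : ∀ {G H : Graph V} → G ≐ H → Alternating G → Alternating H
    alternating-cong {G} {H} G≐H A = record
      { colour = colour ; colour-comm = colour-comm ; colour-cong = colour-cong
      ; alternates = λ {x} {y} {z} d e n → alternates d (trans (s x y) (trans e (sym (s x z))))
          (λ e′ → n (trans (sym (s y z)) (trans e′ (s x y))))
      }
      where
      open Alternating A
      s : ∀ x y → adj G x y ≡ adj H x y
      s x y = ⌊⌋-cong (Equivalence.to (G≐H x y)) (Equivalence.from (G≐H x y))

    module _ (G : Graph V) where

      private
        -- Stated for any graph `H`, so that the complement of `G` takes care of independent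
        -- triples.
        triple-rel : ∀ {x y z p q} (H : Graph V) → Adj H x y → Adj H x z → Adj H y z →
          ⟅_,_,_⟆ {V} x y z p → ⟅_,_,_⟆ {V} x y z q → ¬ p ≈ q → Adj H p q
        triple-rel H xy xz yz (inj₁ a) (inj₁ b) n = ⊥-elim (n (≈-trans a (≈-sym b)))
        triple-rel H xy xz yz (inj₁ a) (inj₂ (inj₁ b)) n = Adj-cong H (≈-sym a) (≈-sym b) xy
        triple-rel H xy xz yz (inj₁ a) (inj₂ (inj₂ b)) n = Adj-cong H (≈-sym a) (≈-sym b) xz
        triple-rel H xy xz yz (inj₂ (inj₁ a)) (inj₁ b) n = Adj-cong H (≈-sym a) (≈-sym b) (Graph.adj-sym H xy)
        triple-rel H xy xz yz (inj₂ (inj₁ a)) (inj₂ (inj₁ b)) n = ⊥-elim (n (≈-trans a (≈-sym b)))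
        triple-rel H xy xz yz (inj₂ (inj₁ a)) (inj₂ (inj₂ b)) n = Adj-cong H (≈-sym a) (≈-sym b) yz
        triple-rel H xy xz yz (inj₂ (inj₂ a)) (inj₁ b) n = Adj-cong H (≈-sym a) (≈-sym b) (Graph.adj-sym H xz)
        triple-rel H xy xz yz (inj₂ (inj₂ a)) (inj₂ (inj₁ b)) n = Adj-cong H (≈-sym a) (≈-sym b) (Graph.adj-sym H yz)
        triple-rel H xy xz yz (inj₂ (inj₂ a)) (inj₂ (inj₂ b)) n = ⊥-elim (n (≈-trans a (≈-sym b)))

      homogeneous⇔mono : ∀ {x y z} → Distinct₃ {V} x y z →
        Homogeneous G (⟅_,_,_⟆ {V} x y z) ⇔ Mono (adj G x y) (adj G x z) (adj G y z)
      homogeneous⇔mono {x} {y} {z} (x≉y , x≉z , y≉z) = mk⇔ to from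
        where
        ∈₁ : ⟅_,_,_⟆ {V} x y z x
        ∈₁ = inj₁ ≈-refl
        ∈₂ : ⟅_,_,_⟆ {V} x y z y
        ∈₂ = inj₂ (inj₁ ≈-refl)
        ∈₃ : ⟅_,_,_⟆ {V} x y z z
        ∈₃ = inj₂ (inj₂ ≈-refl)
        to : Homogeneous G (⟅_,_,_⟆ {V} x y z) → Mono (adj G x y) (adj G x z) (adj G y z)
        to (inj₁ c) = trans xy (sym (⌊⌋-true (c ∈₁ ∈₃ x≉z))) , trans xy (sym (⌊⌋-true (c ∈₂ ∈₃ y≉z)))
          where xy = ⌊⌋-true (c ∈₁ ∈₂ x≉y)
        to (inj₂ c) = trans xy (sym (⌊⌋-false (c ∈₁ ∈₃))) , trans xy (sym (⌊⌋-false (c ∈₂ ∈₃)))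
          where xy = ⌊⌋-false (c ∈₁ ∈₂)
        from : Mono (adj G x y) (adj G x z) (adj G y z) → Homogeneous G (⟅_,_,_⟆ {V} x y z)
        from (p , q) with em (Adj G x y)
        ... | yes xy = inj₁ (triple-rel G xy (true-⌊⌋ (sym p)) (true-⌊⌋ (sym q)))
        ... | no ¬xy = inj₂ λ a∈ b∈ e → proj₂ (triple-rel (complement G) (x≉y , ¬xy)
                 (x≉z , false-⌊⌋ (sym p)) (y≉z , false-⌊⌋ (sym q)) a∈ b∈ (λ a≈b → Graph.adj-irr G a≈b e)) e

    adj-∔ : ∀ (G H : Graph V) x y → adj (G ∔ H) x y ≡ adj G x y xor adj H x y
    adj-∔ G H x y with em (Adj G x y) | em (Adj H x y)
    ... | yes g | yes h = ⌊⌋-false λ { (inj₁ (_ , n)) → n h ; (inj₂ (n , _)) → n g }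
    ... | yes g | no ¬h = ⌊⌋-true (inj₁ (g , ¬h))
    ... | no ¬g | yes h = ⌊⌋-true (inj₂ (¬g , h))
    ... | no ¬g | no ¬h = ⌊⌋-false λ { (inj₁ (g , _)) → ¬g g ; (inj₂ (_ , h)) → ¬h h }

    module _ {U : Graph V} where

      -- `G` itself is the colouring. As `G′` is the sum of `U` and `G`, equal homogeneity of a
      -- triple is the hypothesis of `mono-flip⁻¹`.
      sameTriples⇒alternating : ∀ {G G′} → SameHomogeneousTriples G G′ → U ≐ (G ∔ G′) → Alternating U
      sameTriples⇒alternating {G} {G′} same U≐ = record
        { colour = adj G ; colour-comm = adj-comm G ; colour-cong = adj-cong G
        ; alternates = λ {x} {y} {z} d e n → mono-flip⁻¹ (adj U x y) (adj U y z) _ _ _ (flip d e) n }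
        where
        open Equivalence
        adj-G′ : ∀ x y → adj G′ x y ≡ adj U x y xor adj G x y
        adj-G′ x y rewrite ⌊⌋-cong (to (U≐ x y)) (from (U≐ x y)) | adj-∔ G G′ x y
          with adj G x y | adj G′ x y
        ... | true  | true  = refl
        ... | true  | false = refl
        ... | false | true  = refl
        ... | false | false = refl
        flip : ∀ {x y z} → Distinct₃ {V} x y z → adj U x y ≡ adj U x z →
          Mono (adj G x y) (adj G x z) (adj G y z) ⇔
          Mono (adj U x y xor adj G x y) (adj U x y xor adj G x z) (adj U y z xor adj G y z)
        flip {x} {y} {z} d e
          rewrite sym (adj-G′ x y) | sym (adj-G′ y z)
                | trans (cong (_xor adj G x z) e) (sym (adj-G′ x z)) = mk⇔
            (λ m → to (homogeneous⇔mono G′ d) (to (same x y z d) (from (homogeneous⇔mono G d) m)))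
            (λ m → to (homogeneous⇔mono G d) (from (same x y z d) (from (homogeneous⇔mono G′ d) m)))

      -- The pairs of colour `true` form `G`, and `G′` has to be `U ∔ G` because adding `G` twice
      -- cancels. The hypotheses of `mono-flip` are the alternation at the three vertices of the
      -- triple.
      alternating⇒sameTriples : Alternating U →
        Σ[ G ∈ Graph V ] Σ[ G′ ∈ Graph V ] SameHomogeneousTriples G G′ × U ≐ (G ∔ G′)
      alternating⇒sameTriples A = G , U ∔ G , same , λ x y → mk⇔
          (λ e → true-⌊⌋ (trans (sym (U≐ x y)) (⌊⌋-true e)))
          (λ e → true-⌊⌋ (trans (U≐ x y) (⌊⌋-true e)))
        where
        open Alternating A
        open Equivalence
        G : Graph V
        G = record
          { Adj = λ x y → ¬ x ≈ y × colour x y ≡ true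
          ; adj-sym = λ {x} {y} (n , e) → n ∘ ≈-sym , trans (colour-comm y x) e
          ; adj-irr = λ x≈y (x≉y , _) → x≉y x≈y
          ; adj-resp = (λ p (n , e) → (λ q → n (≈-trans q (≈-sym p))) , trans (colour-cong ≈-refl (≈-sym p)) e)
                     , (λ p (n , e) → (λ q → n (≈-trans p q)) , trans (colour-cong (≈-sym p) ≈-refl) e)
          }
        adj-G : ∀ {x y} → ¬ x ≈ y → adj G x y ≡ colour x y
        adj-G n = trans (⌊⌋-cong proj₂ (n ,_)) (⌊≡true⌋ _)
        U≐ : ∀ x y → adj U x y ≡ adj (G ∔ (U ∔ G)) x y
        U≐ x y rewrite adj-∔ G (U ∔ G) x y | adj-∔ U G x y with adj U x y | adj G x y
        ... | true  | true  = refl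
        ... | true  | false = refl
        ... | false | true  = refl
        ... | false | false = refl
        flip : ∀ {x y z} → Distinct₃ {V} x y z → Mono (adj G x y) (adj G x z) (adj G y z) ⇔
          Mono (adj (U ∔ G) x y) (adj (U ∔ G) x z) (adj (U ∔ G) y z)
        flip {x} {y} {z} d@(x≉y , x≉z , y≉z)
          rewrite adj-∔ U G x y | adj-∔ U G x z | adj-∔ U G y z
                | adj-G x≉y | adj-G x≉z | adj-G y≉z
          = mono-flip (adj U x y) (adj U x z) (adj U y z) _ _ _
              (alternates d)
              (λ p q r → alternates (distinct₂₁₃ d) (trans (adj-comm U y x) p)
                 (λ s → q (trans s (adj-comm U y x))) (trans (colour-comm y x) r))
              (λ p q r → alternates (distinct₃₁₂ d)
                 (trans (adj-comm U z x) (trans p (adj-comm U y z)))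
                 (λ s → q (trans s (adj-comm U z x)))
                 (trans (colour-comm z x) (trans r (colour-comm y z))))
        same : SameHomogeneousTriples G (U ∔ G)
        same x y z d = mk⇔
          (λ h → from (homogeneous⇔mono (U ∔ G) d) (to (flip d) (to (homogeneous⇔mono G d) h)))
          (λ h → from (homogeneous⇔mono G d) (from (flip d) (to (homogeneous⇔mono (U ∔ G) d) h)))

      alternating⇒bipartite : Alternating U → Bipartite (S U)
      alternating⇒bipartite A = record
          { to = λ (edge a b _) → colour a b
          ; cong = λ { {edge a b _} {edge c d _} → joins-colour } }
        , λ { {edge a b ab} {edge c d cd} (x , y , z , dis@(x≉y , x≉z , y≉z) , ju , jv , ¬yz) e →
              let xy = Joins-adj ju ab ; xz = Joins-adj jv cd in
              alternates dis (trans xy (sym xz))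
                (λ p → contradiction (trans (sym (⌊⌋-false ¬yz)) (trans p xy)) λ ())
                (trans (sym (joins-colour ju)) (trans e (joins-colour jv))) }
        where
        open Alternating A
        joins-colour : ∀ {a b c d} → (a ≈ c × b ≈ d) ⊎ (a ≈ d × b ≈ c) → colour a b ≡ colour c d
        joins-colour (inj₁ (p , q)) = colour-cong p q
        joins-colour (inj₂ (p , q)) = trans (colour-cong p q) (colour-comm _ _)
        Joins-adj : ∀ {a b x y} → (a ≈ x × b ≈ y) ⊎ (a ≈ y × b ≈ x) → Adj U a b → adj U x y ≡ true
        Joins-adj (inj₁ (p , q)) e = ⌊⌋-true (Adj-cong U p q e)
        Joins-adj (inj₂ (p , q)) e = ⌊⌋-true (Graph.adj-sym U (Adj-cong U p q e))

    alternating⇒bipartites : ∀ {U} → Alternating U → Bipartite (S U) × Bipartite (S (complement U))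
    alternating⇒bipartites A =
      alternating⇒bipartite A , alternating⇒bipartite (complement-alternating A)

    abstract
      edgeColouring : ∀ {G} → Bipartite (S G) → EdgeColouring G
      edgeColouring {G} (c , proper) = record
        { colour = f ; colour-comm = f-comm ; colour-cong = f-cong ; proper = f-proper }
        where
        f′ : ∀ {x y} → Dec (Adj G x y) → Bool
        f′ (yes e) = Func.to c (edge _ _ e)
        -- Non-edges, about which `c` says nothing, get a default colour.
        f′ (no _) = false
        f : Carrier → Carrier → Bool
        f x y = f′ (em (Adj G x y))
        f-edge : ∀ {x y} (e : Adj G x y) → f x y ≡ Func.to c (edge x y e)
        f-edge {x} {y} e with em (Adj G x y)
        ... | yes e′ = Func.cong c (inj₁ (≈-refl , ≈-refl))
        ... | no ¬e = contradiction e ¬e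
        f-non : ∀ {x y} → ¬ Adj G x y → f x y ≡ false
        f-non {x} {y} ¬e with em (Adj G x y)
        ... | yes e = contradiction e ¬e
        ... | no _ = refl
        f-comm : ∀ x y → f x y ≡ f y x
        f-comm x y with em (Adj G x y)
        ... | yes e = sym (trans (f-edge (Graph.adj-sym G e)) (Func.cong c (inj₂ (≈-refl , ≈-refl))))
        ... | no ¬e = sym (f-non (¬e ∘ Graph.adj-sym G))
        f-cong : ∀ {x x′ y y′} → x ≈ x′ → y ≈ y′ → f x y ≡ f x′ y′
        f-cong {x} {x′} {y} {y′} p q with em (Adj G x y)
        ... | yes e = sym (trans (f-edge (Adj-cong G p q e)) (Func.cong c (inj₁ (≈-sym p , ≈-sym q))))
        ... | no ¬e = sym (f-non (¬e ∘ Adj-cong G (≈-sym p) (≈-sym q)))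
        f-proper : ∀ {x y z} → Distinct₃ {V} x y z → Adj G x y → Adj G x z → ¬ Adj G y z → f x y ≢ f x z
        f-proper {x} {y} {z} d xy xz ¬yz e =
          proper (x , y , z , d , inj₁ (≈-refl , ≈-refl) , inj₁ (≈-refl , ≈-refl) , ¬yz)
            (trans (sym (f-edge xy)) (trans e (f-edge xz)))

    -- Alternation compares two edges or two non-edges, never one of each, so the two colourings can
    -- be glued without any compatibility.
    bipartites⇒alternating : ∀ {U} → Bipartite (S U) → Bipartite (S (complement U)) → Alternating U
    bipartites⇒alternating {U} b b̅ = record
        { colour = h
        ; colour-comm = λ x y → if-cong (adj-comm U x y) (C.colour-comm x y) (C̅.colour-comm x y)
        ; colour-cong = λ p q → if-cong (adj-cong U p q) (C.colour-cong p q) (C̅.colour-cong p q)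
        ; alternates = alt
        }
      where
      module C = EdgeColouring (edgeColouring b)
      module C̅ = EdgeColouring (edgeColouring b̅)
      h : Carrier → Carrier → Bool
      h x y = if adj U x y then C.colour x y else C̅.colour x y
      if-cong : ∀ {a a′ b b′ c c′ : Bool} → a ≡ a′ → b ≡ b′ → c ≡ c′ →
        (if a then b else c) ≡ (if a′ then b′ else c′)
      if-cong refl refl refl = refl
      h-edge : ∀ {x y} → Adj U x y → h x y ≡ C.colour x y
      h-edge {x} {y} e = cong (if_then C.colour x y else C̅.colour x y) (⌊⌋-true e)
      h-nonedge : ∀ {x y} → ¬ Adj U x y → h x y ≡ C̅.colour x y
      h-nonedge {x} {y} ¬e = cong (if_then C.colour x y else C̅.colour x y) (⌊⌋-false ¬e)
      alt : ∀ {x y z} → Distinct₃ {V} x y z →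
        adj U x y ≡ adj U x z → adj U y z ≢ adj U x y → h x y ≢ h x z
      alt {x} {y} {z} d@(x≉y , x≉z , y≉z) e n = case em (Adj U x y) of λ
        { (yes xy) → let xz = true-⌊⌋ (trans (sym e) (⌊⌋-true xy)) in λ p →
            C.proper d xy xz (λ yz → n (trans (⌊⌋-true yz) (sym (⌊⌋-true xy))))
              (trans (sym (h-edge xy)) (trans p (h-edge xz)))
        ; (no ¬xy) → let ¬xz = false-⌊⌋ (trans (sym e) (⌊⌋-false ¬xy)) in λ p →
            C̅.proper d (x≉y , ¬xy) (x≉z , ¬xz) (λ (_ , ¬yz) → n (trans (⌊⌋-false ¬yz) (sym (⌊⌋-false ¬xy))))
              (trans (sym (h-nonedge ¬xy)) (trans p (h-nonedge ¬xz))) }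

  -- Graphs with a triangle and an independent triple

  module _ {V : Setoid 0ℓ 0ℓ} {U : Graph V} (A : Alternating U) where
    open Setoid V using (Carrier; _≈_) renaming (refl to ≈-refl; sym to ≈-sym; trans to ≈-trans)
    open Alternating A

    -- An induced copy in `U` of the graph with adjacency matrix `M`.
    record Frame {n} (M : Matrix n) : Set where
      field
        vertex    : Fin n → Carrier
        injective : ∀ {i j} → i ≢ j → ¬ vertex i ≈ vertex j
        matrix    : ∀ i j → adj U (vertex i) (vertex j) ≡ M i j

    frame-cong : ∀ {n} {M N : Matrix n} → (∀ i j → M i j ≡ N i j) → Frame M → Frame N
    frame-cong M≡N F = record
      { vertex = vertex ; injective = injective ; matrix = λ i j → trans (matrix i j) (M≡N i j) }
      where open Frame F

    adj-irrefl : ∀ x → adj U x x ≡ false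
    adj-irrefl x = ⌊⌋-false (Graph.adj-irr U ≈-refl)

    extendFrame : ∀ {n} {M : Matrix n} (F : Frame M) {t : Fin n → Bool} v →
      (∀ i → ¬ v ≈ Frame.vertex F i) → (∀ i → adj U v (Frame.vertex F i) ≡ t i) → Frame (extend t M)
    extendFrame {M = M} F {t} v fresh adjacency = record
      { vertex = v Vector.∷ vertex
      ; injective = λ { {zero}  {zero}  n → ⊥-elim (n refl)
                      ; {zero}  {suc j} n → fresh j
                      ; {suc i} {zero}  n → fresh i ∘ ≈-sym
                      ; {suc i} {suc j} n → injective (n ∘ cong suc) }
      ; matrix = λ { zero    zero    → adj-irrefl v
                   ; zero    (suc j) → adjacency j
                   ; (suc i) zero    → trans (adj-comm U (vertex i) v) (adjacency i)
                   ; (suc i) (suc j) → matrix i j }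
      }
      where open Frame F

    module _ {n} {M : Matrix n} (F : Frame M) where
      open Frame F

      private
        col : Fin n → Fin n → Bool
        col x y = colour (vertex x) (vertex y)

      step-≢ : ∀ {x y z} → Step M x y z → col x y ≢ col x z
      step-≢ {x} {y} {z} ((x≢y , x≢z , y≢z) , e , n) =
        alternates (injective x≢y , injective x≢z , injective y≢z)
          (trans (matrix x y) (trans e (sym (matrix x z))))
          (λ p → n (trans (sym (matrix y z)) (trans p (matrix x y))))

      -- Three pairs at one vertex cannot have pairwise different colours when there are only two.
      no-claw : ¬ Claw M
      no-claw (x , a , b , ab , c , ac , bc) =
        step-≢ ac (≢-≢⇒≡ (step-≢ ab) (step-≢ bc))

      step-step : ∀ {w x y z} → Step M x y z → Step M z x w → col x y ≡ col z w
      step-step {w} {x} {y} {z} p q =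
        ≢-≢⇒≡ (step-≢ p) (λ e → step-≢ q (trans (colour-comm (vertex z) (vertex x)) e))

      -- Eight of the nine steps, taken two at a time, carry the colour of `vd` over `vc`, `ea` and
      -- `ed` to `da`; the ninth says that `da` and `dv` differ.
      no-net : ∀ {v a b c d e} → ¬ Net M v a b c d e
      no-net {v} {a} {b} {c} {d} {e} (vdb , vbc , vce , eva , eab , ebd , dec , dca , dav) =
        step-≢ dav (sym (trans (colour-comm (vertex d) (vertex v))
          (trans (≢-≢⇒≡ (step-≢ vdb) (step-≢ vbc))
          (trans (step-step vce eva)
          (trans (≢-≢⇒≡ (step-≢ eab) (step-≢ ebd))
          (trans (colour-comm (vertex e) (vertex d)) (≢-≢⇒≡ (step-≢ dec) (step-≢ dca))))))))

    -- For `s = true` this excludes the claw with centre `x`, for `s = false` a triangle together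
    -- with a vertex adjacent to none of its corners.
    claw⊥ : ∀ s {x a b c} → ¬ x ≈ a × ¬ x ≈ b × ¬ x ≈ c → Distinct₃ {V} a b c →
      adj U x a ≡ s → adj U x b ≡ s → adj U x c ≡ s →
      adj U a b ≡ not s → adj U a c ≡ not s → adj U b c ≡ not s → ⊥
    claw⊥ s {x} {a} {b} {c} (x≉a , x≉b , x≉c) (a≉b , a≉c , b≉c) xa xb xc ab ac bc =
      col x≉a x≉c a≉c xa xc ac (≢-≢⇒≡ (col x≉a x≉b a≉b xa xb ab) (col x≉b x≉c b≉c xb xc bc))
      where
      col : ∀ {x y z} → ¬ x ≈ y → ¬ x ≈ z → ¬ y ≈ z → adj U x y ≡ s → adj U x z ≡ s →
        adj U y z ≡ not s → colour x y ≢ colour x z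
      col p q r xy xz yz = alternates (p , q , r) (trans xy (sym xz))
        (λ e → not-¬ (trans e xy) yz)

    separated : ∀ {x y z s} → adj U x z ≡ s → adj U y z ≡ not s → ¬ x ≈ y
    separated xz yz x≈y = not-¬ (trans (sym (adj-cong U x≈y ≈-refl)) xz) yz

    adjacent⇒≉ : ∀ {x y} → adj U x y ≡ true → ¬ x ≈ y
    adjacent⇒≉ {x} {y} xy = separated xy (adj-irrefl y)

    private
      flip : ∀ {x y s} → adj U x y ≡ s → adj U y x ≡ s
      flip {x} {y} = trans (adj-comm U y x)

    bullFrame : ∀ {a b c d e} →
      adj U a b ≡ true → adj U a c ≡ true → adj U b c ≡ true → adj U b d ≡ true → adj U c e ≡ true →
      adj U a d ≡ false → adj U a e ≡ false → adj U b e ≡ false → adj U c d ≡ false → adj U d e ≡ false →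
      Frame bull
    bullFrame {a} {b} {c} {d} {e} ab ac bc bd ce ad ae be cd de = frame-cong
      (from-yes (all? λ i → all? λ j → extend ta (extend tb (extend tc (extend td (extend te M∅)))) i j
                                         Bool.≟ bull i j))
      -- The vertices enter from `e` to `a`, since each new one takes number 0. A third vertex
      -- adjacent to only one of two others shows that these are distinct.
      (extendFrame (extendFrame (extendFrame (extendFrame (extendFrame
        ∅
        e (λ ()) (λ ()))
        d (λ { 0F → separated (flip bd) (flip be) }) (λ { 0F → de }))
        c (λ { 0F → separated (flip ac) (flip ad) ; 1F → adjacent⇒≉ ce }) (λ { 0F → cd ; 1F → ce }))
        b (λ { 0F → adjacent⇒≉ bc ; 1F → adjacent⇒≉ bd ; 2F → separated (flip ab) (flip ae) })
        (λ { 0F → bc ; 1F → bd ; 2F → be }))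
        a (λ { 0F → adjacent⇒≉ ab ; 1F → adjacent⇒≉ ac ; 2F → separated ac (flip cd) ; 3F → separated ab (flip be) })
        (λ { 0F → ab ; 1F → ac ; 2F → ad ; 3F → ae }))
      where
      M∅ : Matrix 0
      M∅ ()
      te : Fin 0 → Bool
      te ()
      ∅ : Frame M∅
      ∅ = record { vertex = λ () ; injective = λ { {()} } ; matrix = λ () }
      td : Fin 1 → Bool
      td _ = false
      tc : Fin 2 → Bool
      tc 0F = false
      tc 1F = true
      tb : Fin 3 → Bool
      tb 0F = true
      tb 1F = true
      tb 2F = false
      ta : Fin 4 → Bool
      ta 0F = true
      ta 1F = true
      ta 2F = false
      ta 3F = false

    Triangle : Carrier → Carrier → Carrier → Set
    Triangle a b c = adj U a b ≡ true × adj U a c ≡ true × adj U b c ≡ true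

    Independent : Carrier → Carrier → Carrier → Set
    Independent d e f = Distinct₃ {V} d e f × adj U d e ≡ false × adj U d f ≡ false × adj U e f ≡ false

    -- Each of `d` and `e` is adjacent to `b` or `c`, by the co-claw, and neither `b` nor `c` is
    -- adjacent to both, by the claw. So `d` and `e` hang on different vertices of the triangle.
    bull-at : ∀ {a b c d e} → Triangle a b c → Independent a d e → Frame bull
    bull-at {a} {b} {c} {d} {e} (ab , ac , bc) ((a≉d , a≉e , d≉e) , ad , ae , de) =
      go (adj U d b) (adj U d c) (adj U e b) (adj U e c) refl refl refl refl
      where
      meets : ∀ {d} → ¬ a ≈ d → adj U a d ≡ false → adj U d b ≡ false → adj U d c ≡ false → ⊥
      meets a≉d ad db dc = claw⊥ false
        (a≉d ∘ ≈-sym , (λ d≈b → separated (flip ab) (flip ad) (≈-sym d≈b))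
                     , (λ d≈c → separated (flip ac) (flip ad) (≈-sym d≈c)))
        (adjacent⇒≉ ab , adjacent⇒≉ ac , adjacent⇒≉ bc) (flip ad) db dc ab ac bc
      avoids : ∀ {b} → adj U a b ≡ true → adj U d b ≡ true → adj U e b ≡ true → ⊥
      avoids ab db eb = claw⊥ true (adjacent⇒≉ (flip ab) , adjacent⇒≉ (flip db) , adjacent⇒≉ (flip eb))
        (a≉d , a≉e , d≉e) (flip ab) (flip db) (flip eb) ad ae de
      go : ∀ s t u v → adj U d b ≡ s → adj U d c ≡ t → adj U e b ≡ u → adj U e c ≡ v → Frame bull
      go false false _ _ db dc _ _ = ⊥-elim (meets a≉d ad db dc)
      go _ _ false false _ _ eb ec = ⊥-elim (meets a≉e ae eb ec)
      go true _ true _ db _ eb _ = ⊥-elim (avoids ab db eb)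
      go _ true _ true _ dc _ ec = ⊥-elim (avoids ac dc ec)
      go true false false true db dc eb ec = bullFrame ab ac bc (flip db) (flip ec) ad ae (flip eb) (flip dc) de
      go false true true false db dc eb ec = bullFrame ac ab (flip bc) (flip dc) (flip eb) ad ae (flip ec) (flip db) de

    -- If `a` or `b` is non-adjacent to two of `d`, `e`, `f`, it belongs to an independent triple
    -- and `bull-at` applies. Otherwise both have two neighbours among them, hence a common one,
    -- which forms with `a` and `b` a triangle meeting the independent triple.
    bull-exists : ∀ {a b c d e f} → Triangle a b c → Independent d e f → Frame bull
    bull-exists {a} {b} {c} {d} {e} {f} abc@(ab , ac , bc) def@((d≉e , d≉f , e≉f) , de , df , ef) =
      go (adj U a d) (adj U a e) (adj U a f) (adj U b d) (adj U b e) (adj U b f) refl refl refl refl refl refl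
      where
      misses : ∀ {x y z d e f} → Triangle x y z → Independent d e f →
        adj U x d ≡ false → adj U x e ≡ false → Frame bull
      misses {x} {y} {z} {d} {e} {f} xyz ((d≉e , d≉f , e≉f) , de , df , ef) xd xe = case em (x ≈ d) of λ
        { (yes x≈d) → bull-at xyz (((λ x≈e → d≉e (≈-trans (≈-sym x≈d) x≈e)) , (λ x≈f → d≉f (≈-trans (≈-sym x≈d) x≈f)) , e≉f)
                                  , xe , trans (adj-cong U x≈d ≈-refl) df , ef)
        ; (no x≉d) → case em (x ≈ e) of λ
          { (yes x≈e) → bull-at xyz ((x≉d , (λ x≈f → e≉f (≈-trans (≈-sym x≈e) x≈f)) , d≉f)
                                    , xd , trans (adj-cong U x≈e ≈-refl) ef , df)
          ; (no x≉e) → bull-at xyz ((x≉d , x≉e , d≉e) , xd , xe , de) } }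
      edf : Independent e d f
      edf = (d≉e ∘ ≈-sym , e≉f , d≉f) , flip de , ef , df
      dfe : Independent d f e
      dfe = (d≉f , d≉e , e≉f ∘ ≈-sym) , df , de , flip ef
      efd : Independent e f d
      efd = (e≉f , d≉e ∘ ≈-sym , d≉f ∘ ≈-sym) , ef , flip de , flip df
      fde : Independent f d e
      fde = (d≉f ∘ ≈-sym , e≉f ∘ ≈-sym , d≉e) , flip df , flip ef , de
      bac : Triangle b a c
      bac = flip ab , bc , ac
      go : ∀ s t u s′ t′ u′ → adj U a d ≡ s → adj U a e ≡ t → adj U a f ≡ u →
        adj U b d ≡ s′ → adj U b e ≡ t′ → adj U b f ≡ u′ → Frame bull
      go false false _ _ _ _ p q _ _ _ _ = misses abc def p q
      go false _ false _ _ _ p _ q _ _ _ = misses abc dfe p q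
      go _ false false _ _ _ _ p q _ _ _ = misses abc efd p q
      go _ _ _ false false _ _ _ _ p q _ = misses bac def p q
      go _ _ _ false _ false _ _ _ p _ q = misses bac dfe p q
      go _ _ _ _ false false _ _ _ _ p q = misses bac efd p q
      go true _ _ true _ _ p _ _ q _ _ = bull-at (flip p , flip q , ab) def
      go _ true _ _ true _ _ p _ _ q _ = bull-at (flip p , flip q , ab) edf
      go _ _ true _ _ true _ _ p _ _ q = bull-at (flip p , flip q , ab) fde

    module _ (F : Frame bull) where
      open Frame F

      data Place (v : Carrier) : Point → Set where
        inner : ∀ i → v ≈ vertex i → Place v (bullPoint i)
        outer : ∀ k → (∀ i → ¬ v ≈ vertex i) → (∀ i → adj U v (vertex i) ≡ outerType k i) → Place v (outerPoint k)

      place : ∀ v → ∃ (Place v)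
      place v with em (∃[ i ] v ≈ vertex i)
      ... | yes (i , v≈i) = bullPoint i , inner i v≈i
      ... | no fresh = extension (bull-extension t)
        where
        t : Vec Bool 5
        t = tabulate (λ i → adj U v (vertex i))
        t-lookup : ∀ i → adj U v (vertex i) ≡ lookup t i
        t-lookup i = sym (lookup∘tabulate (λ i → adj U v (vertex i)) i)
        F⁺ : Frame (extend (lookup t) bull)
        F⁺ = extendFrame F v (λ i p → fresh (i , p)) t-lookup
        extension : _ → ∃ (Place v)
        extension (inj₁ (k , type)) = outerPoint k , outer k (λ i p → fresh (i , p)) (λ i → trans (t-lookup i) (type i))
        extension (inj₂ (inj₁ claw)) = ⊥-elim (no-claw F⁺ claw)
        extension (inj₂ (inj₂ (inj₁ net))) = ⊥-elim (no-net F⁺ net)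
        extension (inj₂ (inj₂ (inj₂ net))) = ⊥-elim (no-net F⁺ net)

      place-type : ∀ {v q} → Place v q → ∀ i → adj U v (vertex i) ≡ adj₉ q (bullPoint i)
      place-type (inner j v≈j) i = trans (adj-cong U v≈j ≈-refl) (matrix j i)
      place-type (outer k _ type) i = type i

      outer-outer : ∀ {u v} k l → (∀ i → ¬ u ≈ vertex i) → (∀ i → adj U u (vertex i) ≡ outerType k i) →
        (∀ i → ¬ v ≈ vertex i) → (∀ i → adj U v (vertex i) ≡ outerType l i) → ¬ u ≈ v →
        k ≢ l × adj U u v ≡ adj₉ (outerPoint k) (outerPoint l)
      outer-outer {u} {v} k l u-fresh u-type v-fresh v-type u≉v
        with bull-extension₂ (adj U u v) k l
      ... | inj₁ r = r
      ... | inj₂ claw = ⊥-elim (no-claw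
              (extendFrame (extendFrame F v v-fresh v-type) u
                (λ { zero → u≉v ; (suc i) → u-fresh i }) (λ { zero → refl ; (suc i) → u-type i })) claw)

      -- Distinct vertices of the same outer type are excluded by `bull-extension₂`; their equality
      -- then follows by double negation.
      place-injective : ∀ {u v p q} → Place u p → Place v q → p ≡ q → u ≈ v
      place-injective (inner i u≈i) (inner j v≈j) e with refl ← bullPoint-injective i j e =
        ≈-trans u≈i (≈-sym v≈j)
      place-injective (inner i _) (outer k _ _) e = ⊥-elim (bullPoint≢outerPoint i k e)
      place-injective (outer k _ _) (inner i _) e = ⊥-elim (bullPoint≢outerPoint i k (sym e))
      place-injective (outer k u-fresh u-type) (outer l v-fresh v-type) e = ¬¬-elim λ u≉v →
        proj₁ (outer-outer k l u-fresh u-type v-fresh v-type u≉v) (outerPoint-injective k l e)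

      place-adj : ∀ {u v p q} → Place u p → Place v q → ¬ u ≈ v → adj U u v ≡ adj₉ p q
      place-adj {u} {v} {p} P (inner i v≈i) _ = trans (adj-cong U ≈-refl v≈i) (place-type P i)
      place-adj {u} {v} {p} {q} (inner i u≈i) Q _ =
        trans (adj-cong U u≈i ≈-refl) (trans (flip (place-type Q i)) (adj₉-comm q p))
      place-adj (outer k u-fresh u-type) (outer l v-fresh v-type) u≉v =
        proj₂ (outer-outer k l u-fresh u-type v-fresh v-type u≉v)

      induced-in-P₉ : InducedSubgraphOf U P₉
      induced-in-P₉ = (λ q → ∃[ v ] point v ≡ q)
        , record
            { to = λ v → point v , v , refl
            ; from = λ (_ , v , _) → v
            ; to-cong = point-cong
            ; from-cong = λ { {_ , _ , refl} {_ , _ , refl} → point-injective }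
            ; inverse = (λ { {_ , _ , refl} → point-cong }) , (λ { {_} {_ , _ , refl} → point-injective })
            }
        , λ u v → mk⇔
            (λ e → adj₉⇒P₉ (trans (sym (point-adj (λ u≈v → Graph.adj-irr U u≈v e))) (⌊⌋-true e)))
            (λ e → true-⌊⌋ (trans (point-adj (λ u≈v → Graph.adj-irr P₉ (point-cong u≈v) e)) (P₉⇒adj₉ e)))
        where
        rep = proj₁ (choice V)
        rep-≈ = proj₁ (proj₂ (choice V))
        -- Going through the representative makes `point` respect `≈`.
        point : Carrier → Point
        point v = proj₁ (place (rep v))
        point-cong : ∀ {u v} → u ≈ v → point u ≡ point v
        point-cong u≈v = cong (proj₁ ∘ place) (proj₂ (proj₂ (choice V)) u≈v)
        point-injective : ∀ {u v} → point u ≡ point v → u ≈ v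
        point-injective {u} {v} e = ≈-trans (≈-sym (rep-≈ u))
          (≈-trans (place-injective (proj₂ (place (rep u))) (proj₂ (place (rep v))) e) (rep-≈ v))
        point-adj : ∀ {u v} → ¬ u ≈ v → adj U u v ≡ adj₉ (point u) (point v)
        point-adj {u} {v} u≉v = trans (adj-cong U (≈-sym (rep-≈ u)) (≈-sym (rep-≈ v)))
          (place-adj (proj₂ (place (rep u))) (proj₂ (place (rep v)))
            (λ p → u≉v (≈-trans (≈-sym (rep-≈ u)) (≈-trans p (rep-≈ v)))))

  -- Alternating colourings from property (3)

  module _ {V : Setoid 0ℓ 0ℓ} {U : Graph V} where
    open Setoid V using (Carrier; _≈_) renaming (refl to ≈-refl; sym to ≈-sym; trans to ≈-trans)

    P₉-alternating : InducedSubgraphOf U P₉ → Alternating U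
    P₉-alternating (_ , f , U⇔P₉) = record
      { colour = λ u v → colour₉ (point u) (point v)
      ; colour-comm = λ u v → colour₉-comm (point u) (point v)
      ; colour-cong = λ p q → cong₂ colour₉ (to-cong p) (to-cong q)
      ; alternates = λ {x} {y} {z} (x≉y , x≉z , y≉z) e n → colour₉-alternates
          (x≉y ∘ point-injective) (x≉z ∘ point-injective) (y≉z ∘ point-injective)
          (trans (sym (point-adj x y)) (trans e (point-adj x z)))
          (λ p → n (trans (point-adj y z) (trans p (sym (point-adj x y)))))
      }
      where
      open Inverse f
      point : Carrier → Point
      point v = proj₁ (to v)
      point-injective : ∀ {u v} → point u ≡ point v → u ≈ v
      point-injective {u} {v} p =
        ≈-trans (≈-sym (strictlyInverseʳ u)) (≈-trans (from-cong {to u} {to v} p) (strictlyInverseʳ v))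
      point-adj : ∀ u v → adj U u v ≡ adj₉ (point u) (point v)
      point-adj u v = trans (⌊⌋-cong (P₉⇒adj₉ ∘ Equivalence.to (U⇔P₉ u v)) (Equivalence.from (U⇔P₉ u v) ∘ adj₉⇒P₉))
        (⌊≡true⌋ _)

    -- Two edges at `x` with different other ends are one incoming and one outgoing, so their tails
    -- lie on different sides. For non-edges `xy` and `xz` with `yz` an edge, `y` and `z` lie on
    -- different sides.
    orientation⇒alternating : Orientation U → Alternating U
    orientation⇒alternating O = record
      { colour = colour
      ; colour-comm = comm
      ; colour-cong = λ {x} {x′} {y} {y′} p q → colour-≡ (adj-cong U p q) (side-cong p) (side-cong q)
          (⌊⌋-cong (⟶-resp q p) (⟶-resp (≈-sym q) (≈-sym p)))
      ; alternates = λ {x} {y} {z} (_ , _ , y≉z) e n → alt y≉z e n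
      }
      where
      open Orientation O
      -- Here `a` is the adjacency of `x` and `y`, `s` and `t` are their sides, and `r` tells
      -- whether `y ⟶ x`; for an edge with `r` true the tail is `y`, of side `not s`.
      mix : Bool → Bool → Bool → Bool → Bool
      mix a s t r = if a then s xor r else s xor t
      colour : Carrier → Carrier → Bool
      colour x y = mix (adj U x y) (side x) (side y) ⌊ y ⟶ x ⌋
      colour-≡ : ∀ {a a′ s s′ t t′ r r′} → a ≡ a′ → s ≡ s′ → t ≡ t′ → r ≡ r′ → mix a s t r ≡ mix a′ s′ t′ r′
      colour-≡ refl refl refl refl = refl
      out-edge : ∀ {x y} → Adj U x y → x ⟶ y → colour x y ≡ side x
      out-edge {x} {y} e p = trans (colour-≡ {s = side x} {t = side y} (⌊⌋-true e) refl refl (⌊⌋-false (⟶-asym p))) (Bool.xor-identityʳ _)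
      in-edge : ∀ {x y} → Adj U x y → y ⟶ x → colour x y ≡ not (side x)
      in-edge {x} {y} e p = trans (colour-≡ {s = side x} {t = side y} (⌊⌋-true e) refl refl (⌊⌋-true p)) (Bool.xor-comm (side x) true)
      nonedge : ∀ {x y} → ¬ Adj U x y → colour x y ≡ side x xor side y
      nonedge {x} {y} ¬e = colour-≡ {s = side x} {t = side y} {r = ⌊ y ⟶ x ⌋} (⌊⌋-false ¬e) refl refl refl
      comm : ∀ x y → colour x y ≡ colour y x
      comm x y = case em (Adj U x y) of λ
        { (no ¬e) → trans (nonedge ¬e) (trans (Bool.xor-comm (side x) (side y)) (sym (nonedge (¬e ∘ Graph.adj-sym U))))
        ; (yes e) → case oriented e of λ
          { (inj₁ p) → trans (out-edge e p) (trans (¬-not (side-≢ p)) (sym (in-edge (Graph.adj-sym U e) p)))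
          ; (inj₂ p) → trans (in-edge e p) (trans (sym (¬-not (side-≢ p))) (sym (out-edge (Graph.adj-sym U e) p))) } }
      xor-cancelˡ : ∀ a {b c} → a xor b ≡ a xor c → b ≡ c
      xor-cancelˡ true  = not-injective
      xor-cancelˡ false = id
      side-adj : ∀ {x y} → Adj U x y → side x ≢ side y
      side-adj e = case oriented e of λ { (inj₁ p) → side-≢ p ; (inj₂ p) → side-≢ p ∘ sym }
      alt : ∀ {x y z} → ¬ y ≈ z → adj U x y ≡ adj U x z → adj U y z ≢ adj U x y → colour x y ≢ colour x z
      alt {x} {y} {z} y≉z e n = case em (Adj U x y) of λ
        { (yes xy) → let xz = true-⌊⌋ (trans (sym e) (⌊⌋-true xy)) in case oriented xy , oriented xz of λ
          { (inj₁ p , inj₁ q) → ⊥-elim (y≉z (out-unique p q))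
          ; (inj₂ p , inj₂ q) → ⊥-elim (y≉z (in-unique p q))
          ; (inj₁ p , inj₂ q) → λ c → not-≢ (trans (sym (out-edge xy p)) (trans c (in-edge xz q)))
          ; (inj₂ p , inj₁ q) → λ c → not-≢ (trans (sym (out-edge xz q)) (trans (sym c) (in-edge xy p))) }
        ; (no ¬xy) → λ c → let ¬xz = false-⌊⌋ (trans (sym e) (⌊⌋-false ¬xy)) in
            side-adj {y} {z} (true-⌊⌋ (trans (¬-not n) (cong not (⌊⌋-false ¬xy))))
              (xor-cancelˡ (side x) (trans (sym (nonedge ¬xy)) (trans c (nonedge ¬xz)))) }

    components⇒alternating : ComponentsAreEvenCyclesOrPaths U → Alternating U
    components⇒alternating comps = orientation⇒alternating (components-orientation U choice λ x → case comps x of λ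
      { (inj₁ (n , 3≤n , 2∣n , iso)) → orientation-≅ iso (cycle-orientation n 3≤n 2∣n)
      ; (inj₂ (inj₁ (inj₁ (n , iso)))) → orientation-≅ iso (path-orientation (suc n))
      ; (inj₂ (inj₁ (inj₂ (inj₁ iso)))) → orientation-≅ iso ray-orientation
      ; (inj₂ (inj₁ (inj₂ (inj₂ iso)))) → orientation-≅ iso doubleRay-orientation
      ; (inj₂ (inj₂ (u , u-only))) → record
          { _⟶_ = λ _ _ → ⊥ ; ⟶-resp = λ _ _ ()
          ; oriented = λ {v} {w} e → ⊥-elim (Graph.adj-irr U (≈-trans (u-only v) (≈-sym (u-only w))) e)
          ; out-unique = λ () ; in-unique = λ () ; ⟶-asym = λ () ; side = λ _ → true
          ; side-cong = λ _ → refl ; side-≢ = λ () } })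

  -- Components of graphs with a proper 2-edge-colouring

  least : (P : ℕ → Set) → ∀ n → P n → ∃[ m ] P m × ∀ {k} → k < m → ¬ P k
  least P = <-rec (λ n → P n → ∃[ m ] P m × ∀ {k} → k < m → ¬ P k) λ n rec p → case em (∃[ k ] k < n × P k) of λ
     { (yes (k , k<n , q)) → rec k<n q
     ; (no none) → n , p , λ {k} k<n q → none (_ , k<n , q) }

  module _ {V : Setoid 0ℓ 0ℓ} (G : Graph V)
     (colour : Setoid.Carrier V → Setoid.Carrier V → Bool)
     (colour-comm : ∀ x y → colour x y ≡ colour y x)
     (colour-cong : ∀ {x x′ y y′} → Setoid._≈_ V x x′ → Setoid._≈_ V y y′ → colour x y ≡ colour x′ y′)
     (proper : ∀ {x y z} → ¬ Setoid._≈_ V y z → Adj G x y → Adj G x z → colour x y ≢ colour x z)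
     where
    open Setoid V using (Carrier; _≈_; reflexive) renaming (refl to ≈-refl; sym to ≈-sym; trans to ≈-trans)

    private
      rep = proj₁ (choice V)
      rep-≈ = proj₁ (proj₂ (choice V))
      rep-cong : ∀ {x y} → x ≈ y → rep x ≡ rep y
      rep-cong = proj₂ (proj₂ (choice V))

    -- On representatives of the ≈-classes, ≈ becomes ≡.
    X : Set
    X = ∃[ x ] rep x ≡ x

    canonical : Carrier → X
    canonical x = rep x , rep-cong (rep-≈ x)

    X-≡ : ∀ {x y : X} → proj₁ x ≈ proj₁ y → x ≡ y
    -- Once the vertices are identified, two proofs of `rep x ≡ x` remain, equal by uniqueness of
    -- identity proofs.
    X-≡ {x , p} {y , q} e with refl ← trans (sym p) (trans (rep-cong e) q) = cong (x ,_) (uip p q)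

    canonical-unique : ∀ {x y} → x ≈ proj₁ y → canonical x ≡ y
    canonical-unique {x} e = X-≡ (≈-trans (rep-≈ x) e)

    Mate : Bool → Carrier → Carrier → Set
    Mate c x y = Adj G x y × colour x y ≡ c

    mate-unique : ∀ {c x y z} → Mate c x y → Mate c x z → y ≈ z
    mate-unique (xy , p) (xz , q) = ¬¬-elim λ y≉z → proper y≉z xy xz (trans p (sym q))

    mate-cong : ∀ {c x y z} → y ≈ z → Mate c x y → Mate c x z
    mate-cong p (e , q) = Adj-cong G ≈-refl p e , trans (colour-cong ≈-refl (≈-sym p)) q

    private
      σ′ : ∀ c (x : X) → Dec (∃ (Mate c (proj₁ x))) → X
      σ′ c x (yes (y , _)) = canonical y
      σ′ c x (no _)        = x

    -- The other end of the edge is replaced by its canonical representative, so that `σ-involutive`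
    -- can hold up to `≡`, as `Walk` requires.
    σ : Bool → X → X
    σ c x = σ′ c x (em _)

    σ-mate : ∀ {c} {x y : X} → Mate c (proj₁ x) (proj₁ y) → σ c x ≡ y
    σ-mate {c} {x} m with em (∃ (Mate c (proj₁ x)))
    ... | yes (_ , m′) = canonical-unique (mate-unique m′ m)
    ... | no none = ⊥-elim (none (_ , m))

    mate-σ : ∀ c (x : X) → Mate c (proj₁ x) (proj₁ (σ c x)) ⊎ σ c x ≡ x
    mate-σ c x with em (∃ (Mate c (proj₁ x)))
    ... | yes (y , m) = inj₁ (mate-cong (≈-sym (rep-≈ y)) m)
    ... | no none = inj₂ refl

    σ-involutive : ∀ c x → σ c (σ c x) ≡ x
    σ-involutive c x with mate-σ c x
    ... | inj₁ (e , q) = σ-mate (Graph.adj-sym G e , trans (colour-comm _ _) q)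
    ... | inj₂ e = trans (cong (σ c) e) e

    -- If both involutions moved `x` to the same vertex, one edge would have both colours.
    σ-agree : ∀ {c x} → σ c x ≡ σ (not c) x → σ c x ≡ x
    σ-agree {c} {x} e with mate-σ c x | mate-σ (not c) x
    ... | inj₂ p       | _ = p
    ... | inj₁ _       | inj₂ p = trans e p
    ... | inj₁ (_ , p) | inj₁ (_ , q) = ⊥-elim (not-≢ (trans (sym p) (trans (cong (colour (proj₁ x) ∘ proj₁) e) q)))

    σ-connected : ∀ {x} c (y : X) → Connected G x (proj₁ y) → Connected G x (proj₁ (σ c y))
    σ-connected {x} c y p with mate-σ c y
    ... | inj₁ (e , _) = p ◅◅ (inj₂ e ◅ ε)
    ... | inj₂ e = subst (Connected G x ∘ proj₁) (sym e) p

    open Walk σ σ-involutive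

    walk-connected : ∀ {x} c n (y : X) → Connected G x (proj₁ y) → Connected G x (proj₁ (walk c n y))
    walk-connected c zero y p = p
    walk-connected c (suc n) y p = σ-connected _ _ (walk-connected c n y p)

    module _ (x : Carrier) where

      -- The image of `f` meets the component and is closed under both involutions, so it covers the
      -- component. An edge at `f i` leads to the image of `f i` under the involution of its colour,
      -- and `move` locates that vertex.
      component-≅ : {I : Set} (H : Graph (setoid I)) (_⟶_ : Rel I 0ℓ) →
        (∀ {i j} → Adj H i j ⇔ SymClosure _⟶_ i j) →
        (f : I → X) → (∀ {i j} → f i ≡ f j → i ≡ j) → (∀ i → Connected G x (proj₁ (f i))) →
        (∀ {i j} → i ⟶ j → ∃[ c ] σ c (f i) ≡ f j) →
        (∀ c i → ∃[ j ] σ c (f i) ≡ f j × (i ≡ j ⊎ i ⟶ j ⊎ j ⟶ i)) →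
        I → component G x ≅ H
      component-≅ {I} H _⟶_ H⇔⟶ f f-inj connected arrow move i₀ =
        record
          { to = index ; from = λ i → proj₁ (f i) , connected i
          ; to-cong = λ {v} {w} v≈w → f-inj (X-≡ (≈-trans (index-≈ v) (≈-trans v≈w (≈-sym (index-≈ w)))))
          ; from-cong = λ { refl → ≈-refl }
          ; inverse = (λ {i} {v} v≈ → f-inj (X-≡ (≈-trans (index-≈ v) v≈)))
                    , (λ { {v} refl → index-≈ v })
          }
        , λ v w → mk⇔
            (λ e → to (Adj-cong G (≈-sym (index-≈ v)) (≈-sym (index-≈ w)) e))
            (λ e → Adj-cong G (index-≈ v) (index-≈ w) (from (Equivalence.to H⇔⟶ e)))
        where
        reach : ∀ {u v} → Connected G u v → ∀ i → proj₁ (f i) ≈ u → ∃[ j ] proj₁ (f j) ≈ v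
        reach ε i p = i , p
        reach (inj₁ q ◅ r) i p = reach r i (≈-trans p q)
        reach (_◅_ {j = v} (inj₂ e) r) i p =
          let e′ = Adj-cong G (≈-sym p) (≈-sym (rep-≈ v)) e
              j , q , _ = move (colour (proj₁ (f i)) (rep v)) i
              f-j = trans (sym q) (σ-mate {y = canonical v} (e′ , refl))
          in reach r j (≈-trans (reflexive (cong proj₁ f-j)) (rep-≈ v))
        cover : ∀ (v : ∃ (Connected G x)) → ∃[ i ] proj₁ (f i) ≈ proj₁ v
        cover (v , x~v) = reach (Connected-sym G (connected i₀) ◅◅ x~v) i₀ ≈-refl
        index : ∃ (Connected G x) → I
        index v = proj₁ (cover v)
        index-≈ : ∀ v → proj₁ (f (index v)) ≈ proj₁ v
        index-≈ v = proj₂ (cover v)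
        irr : ∀ {i} → ¬ Adj H i i
        irr = Graph.adj-irr H refl
        to : ∀ {i j} → Adj G (proj₁ (f i)) (proj₁ (f j)) → Adj H i j
        to {i} {j} e with move (colour (proj₁ (f i)) (proj₁ (f j))) i
        ... | k , q , r with refl ← f-inj (trans (sym (σ-mate (e , refl))) q) | r
        ... | inj₁ refl = ⊥-elim (Graph.adj-irr G ≈-refl e)
        ... | inj₂ (inj₁ i⟶j) = Equivalence.from H⇔⟶ (fwd i⟶j)
        ... | inj₂ (inj₂ j⟶i) = Equivalence.from H⇔⟶ (bwd j⟶i)
        from-arrow : ∀ {i j} → i ⟶ j → Adj G (proj₁ (f i)) (proj₁ (f j))
        from-arrow {i} {j} i⟶j with arrow i⟶j
        ... | c , q with mate-σ c (f i)
        ... | inj₁ (e , _) = subst (Adj G (proj₁ (f i)) ∘ proj₁) q e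
        -- If `σ c` fixed `f i`, then `i ≡ j` and `H` would have a loop.
        ... | inj₂ p with refl ← f-inj (trans (sym p) q) = ⊥-elim (irr (Equivalence.from H⇔⟶ (fwd i⟶j)))
        from : ∀ {i j} → SymClosure _⟶_ i j → Adj G (proj₁ (f i)) (proj₁ (f j))
        from (fwd p) = from-arrow p
        from (bwd p) = Graph.adj-sym G (from-arrow p)

      ray-component : ∀ c (y : X) → Connected G x (proj₁ y) → σ (not c) y ≡ y →
        (∀ n → walk c n y ≢ walk c (suc n) y) → component G x ≅ ray
      ray-component c y x~y start-stop no-stop = component-≅ ray _ (mk⇔ id id) (λ n → walk c n y)
        -- The ray has no last index; `i + j` bounds both indices compared.
        (λ {i} {j} → walk-injective c y (i + j) (λ {k} _ → no-stop k)
          (λ {d} _ even e → no-stop d (bounce c y start-stop {d} even e)) (ℕ.m≤m+n i j) (ℕ.m≤n+m j i))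
        (λ n → walk-connected c n y x~y) (λ { refl → _ , refl }) next 0
        where
        next : ∀ d i → ∃[ j ] σ d (walk c i y) ≡ walk c j y × (i ≡ j ⊎ suc i ≡ j ⊎ suc j ≡ i)
        next d i with move c y d i
        ... | onward e   = suc i , e , inj₂ (inj₁ refl)
        ... | start refl = 0 , start-stop , inj₁ refl
        ... | back e     = _ , e , inj₂ (inj₂ refl)

      path-component : ∀ c (y : X) → Connected G x (proj₁ y) → σ (not c) y ≡ y → ∀ n →
        walk c n y ≡ walk c (suc n) y → (∀ {k} → k < n → walk c k y ≢ walk c (suc k) y) →
        component G x ≅ path (suc n)
      path-component c y x~y start-stop n end-stop no-stop = component-≅ (path (suc n)) _ (mk⇔ id id)
        (λ i → walk c (toℕ i) y)
        (λ {i} {j} e → toℕ-injective (walk-injective c y n no-stop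
          (λ {d} d<n even e → no-stop d<n (bounce c y start-stop {d} even e)) (toℕ≤pred[n] i) (toℕ≤pred[n] j) e))
        (λ i → walk-connected c (toℕ i) y x~y)
        (λ {i} {j} p → letter c (toℕ i) , cong (λ m → walk c m y) p)
        next zero
        where
        at : ∀ {m} → m ≤ n → Fin (suc n)
        at m≤n = fromℕ< (s≤s m≤n)
        at-toℕ : ∀ {m} (m≤n : m ≤ n) → toℕ (at m≤n) ≡ m
        at-toℕ m≤n = toℕ-fromℕ< (s≤s m≤n)
        next′ : ∀ d k → k ≤ n → ∃[ j ] σ d (walk c k y) ≡ walk c (toℕ j) y × (k ≡ toℕ j ⊎ suc k ≡ toℕ j ⊎ suc (toℕ {suc n} j) ≡ k)
        next′ d k k≤n with move c y d k
        next′ d k k≤n | onward e with ℕ.m≤n⇒m<n∨m≡n k≤n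
        ... | inj₁ k<n  = at k<n , trans e (cong (λ m → walk c m y) (sym (at-toℕ k<n))) , inj₂ (inj₁ (sym (at-toℕ k<n)))
        -- At the last index the next letter fixes the vertex, so the index stays.
        ... | inj₂ refl = at k≤n , trans e (trans (sym end-stop) (cong (λ m → walk c m y) (sym (at-toℕ k≤n)))) , inj₁ (sym (at-toℕ k≤n))
        next′ d k k≤n | start refl = zero , start-stop , inj₁ refl
        next′ d (suc k) k<n | back e = let k≤n = ℕ.<⇒≤ k<n in
          at k≤n , trans e (cong (λ m → walk c m y) (sym (at-toℕ k≤n))) , inj₂ (inj₂ (cong suc (at-toℕ k≤n)))
        next : ∀ d i → ∃[ j ] σ d (walk c (toℕ i) y) ≡ walk c (toℕ j) y × (i ≡ j ⊎ suc (toℕ i) ≡ toℕ j ⊎ suc (toℕ j) ≡ toℕ i)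
        next d i with next′ d (toℕ i) (toℕ≤pred[n] i)
        ... | j , e , inj₁ p = j , e , inj₁ (toℕ-injective p)
        ... | j , e , inj₂ r = j , e , inj₂ r

      cycle-component : ∀ c (y : X) → Connected G x (proj₁ y) → ∀ n (3≤n : 3 ≤ suc n) → parity (suc n) ≡ false →
        walk c (suc n) y ≡ y → (∀ {k} → k < n → walk c (suc k) y ≢ y) →
        (∀ k → walk c k y ≢ walk c (suc k) y) → component G x ≅ cycle (suc n) 3≤n
      cycle-component c y x~y n 3≤n even returns no-return no-stop = component-≅ (cycle (suc n) 3≤n) _ (mk⇔ id id)
        (λ i → walk c (toℕ i) y)
        (λ {i} {j} e → toℕ-injective (walk-injective c y n (λ {k} _ → no-stop k)
          (λ d<n _ e → no-return d<n (sym e)) (toℕ≤pred[n] i) (toℕ≤pred[n] j) e))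
        (λ i → walk-connected c (toℕ i) y x~y)
        (λ { {i} {j} (inj₁ p) → letter c (toℕ i) , cong (λ m → walk c m y) p
           ; {i} {j} (inj₂ (p , q)) → letter c (toℕ i) ,
               trans (cong (λ m → walk c m y) p) (trans returns (cong (λ m → walk c m y) (sym q))) })
        next zero
        where
        at : ∀ {m} → m ≤ n → Fin (suc n)
        at m≤n = fromℕ< (s≤s m≤n)
        at-toℕ : ∀ {m} (m≤n : m ≤ n) → toℕ (at m≤n) ≡ m
        at-toℕ m≤n = toℕ-fromℕ< (s≤s m≤n)
        _⟶_ : ℕ → ℕ → Set
        i ⟶ j = suc i ≡ j ⊎ (suc i ≡ suc n × j ≡ 0)
        -- The closed word has even length, so its last letter is `not c`; undoing it at `y` gives
        -- the last vertex of the cycle.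
        before-start : σ (not c) y ≡ walk c n y
        before-start = trans (cong₂ σ (sym (trans (letter-parity c n) (cong (_xor c) (not-injective even)))) (sym returns))
          (step-back c n y)
        next′ : ∀ d k → k ≤ n → ∃[ j ] σ d (walk c k y) ≡ walk c (toℕ j) y × (k ⟶ toℕ j ⊎ toℕ {suc n} j ⟶ k)
        next′ d k k≤n with move c y d k
        next′ d k k≤n | onward e with ℕ.m≤n⇒m<n∨m≡n k≤n
        ... | inj₁ k<n  = at k<n , trans e (cong (λ m → walk c m y) (sym (at-toℕ k<n))) , inj₁ (inj₁ (sym (at-toℕ k<n)))
        ... | inj₂ refl = zero , trans e returns , inj₁ (inj₂ (refl , refl))
        next′ d k k≤n | start refl = at ℕ.≤-refl , trans before-start (cong (λ m → walk c m y) (sym (at-toℕ ℕ.≤-refl)))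
          , inj₂ (inj₂ (cong suc (at-toℕ ℕ.≤-refl) , refl))
        next′ d (suc k) k<n | back e = let k≤n = ℕ.<⇒≤ k<n in
          at k≤n , trans e (cong (λ m → walk c m y) (sym (at-toℕ k≤n))) , inj₂ (inj₁ (cong suc (at-toℕ k≤n)))
        next : ∀ d i → ∃[ j ] σ d (walk c (toℕ i) y) ≡ walk c (toℕ j) y × (i ≡ j ⊎ toℕ i ⟶ toℕ j ⊎ toℕ j ⟶ toℕ i)
        next d i with next′ d (toℕ i) (toℕ≤pred[n] i)
        ... | j , e , r = j , e , inj₂ r

      doubleRay-component : (∀ (y : X) d n → Connected G x (proj₁ y) → walk d (suc n) y ≢ y) →
        component G x ≅ doubleRay
      doubleRay-component no-return = component-≅ doubleRay _ (mk⇔ id id) z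
        (zigzag-injective true x₀ (λ { y d n (i , refl) → no-return y d n (connected i) }))
        connected (λ { {i} refl → zigzag-suc true x₀ i }) next (+ 0)
        where
        x₀ : X
        x₀ = canonical x
        z : ℤ → X
        z = zigzag true x₀
        x~x₀ : Connected G x (proj₁ x₀)
        x~x₀ = Connected-refl G (≈-sym (rep-≈ x))
        connected : ∀ i → Connected G x (proj₁ (z i))
        connected (+ n)    = walk-connected true n x₀ x~x₀
        connected -[1+ n ] = walk-connected false (suc n) x₀ x~x₀
        next : ∀ d i → ∃[ j ] σ d (z i) ≡ z j × (i ≡ j ⊎ ℤ.suc i ≡ j ⊎ ℤ.suc j ≡ i)
        next d i with zigzag-move true x₀ d i
        ... | inj₁ e = ℤ.suc i , e , inj₂ (inj₁ refl)
        ... | inj₂ (j , p , e) = j , e , inj₂ (inj₂ p)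

      -- A vertex fixed by one of the involutions is an end, from which a path or a ray starts.
      -- Without ends, a closed alternating word gives a cycle, and if there is none the orbit is a
      -- double ray.
      component-shape : IsEvenCycle (component G x) ⊎ IsPath (component G x)
      component-shape = case em (∃[ y ] ∃[ c ] Connected G x (proj₁ y) × σ c y ≡ y) of λ
        -- The colour `c` is missing at the end `y`, so the walk starts with the other one.
        { (yes (y , c , x~y , stop)) → inj₂ (from-end y (not c) x~y
            (subst (λ d → σ d y ≡ y) (sym (not-involutive c)) stop))
        ; (no no-end) → case em (∃[ y ] ∃[ c ] ∃[ n ] Connected G x (proj₁ y) × walk c (suc n) y ≡ y) of λ
          { (yes (y , c , n , x~y , returns)) → inj₁ (round no-end y c x~y (least (λ n → walk c (suc n) y ≡ y) n returns))
          ; (no no-return) → inj₂ (inj₂ (inj₂ (doubleRay-component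
              λ y d n x~y returns → no-return (y , d , n , x~y , returns)))) } }
        where
        from-end : ∀ y c → Connected G x (proj₁ y) → σ (not c) y ≡ y → IsPath (component G x)
        from-end y c x~y stop = case em (∃[ n ] walk c n y ≡ walk c (suc n) y) of λ
          { (yes (n , end)) → let m , end′ , first = least (λ n → walk c n y ≡ walk c (suc n) y) n end in
              inj₁ (m , path-component c y x~y stop m end′ first)
          ; (no no-end) → inj₂ (inj₁ (ray-component c y x~y stop (λ n e → no-end (n , e)))) }
        round : ¬ (∃[ y ] ∃[ c ] Connected G x (proj₁ y) × σ c y ≡ y) → ∀ y c → Connected G x (proj₁ y) →
          ∃[ n ] walk c (suc n) y ≡ y × (∀ {k} → k < n → walk c (suc k) y ≢ y) → IsEvenCycle (component G x)
        round no-end y c x~y (n , returns , first) =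
          suc n , 3≤ n even returns , even-parity (suc n) even ,
          cycle-component c y x~y n (3≤ n even returns) even returns first no-stop
          where
          no-stop : ∀ k → walk c k y ≢ walk c (suc k) y
          no-stop k e = no-end (walk c k y , letter c k , walk-connected c k y x~y , sym e)
          -- A closed word of odd length would stop somewhere and so produce an end.
          even : parity (suc n) ≡ false
          even = ¬-not λ odd →
            let k , _ , stop = odd-collision c y (suc n) 0 odd
                  (sym (trans (cong (λ m → walk c m y) (ℕ.+-identityʳ (suc n))) returns))
            in no-stop k stop
          3≤ : ∀ n → parity (suc n) ≡ false → walk c (suc n) y ≡ y → 3 ≤ suc n
          3≤ zero ()
          -- A return after two steps makes the involutions agree at `y`, which is then an end by
          -- `σ-agree`.
          3≤ (suc zero) _ r = ⊥-elim (no-end (y , c , x~y , σ-agree (trans (sym (σ-involutive (not c) (σ c y))) (cong (σ (not c)) r))))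
          3≤ (suc (suc n)) _ _ = s≤s (s≤s (s≤s z≤n))

  -- Property (3) and the equivalences

  module _ {V : Setoid 0ℓ 0ℓ} where
    open Setoid V using (_≈_) renaming (sym to ≈-sym)

    -- Without triangles, any two edges with a common end are adjacent in `S G`, so its 2-colouring
    -- is a proper edge colouring of `G`.
    triangle-free⇒components : ∀ {G : Graph V} →
      (∀ {x y z} → Adj G x y → Adj G x z → ¬ Adj G y z) →
      Bipartite (S G) → ComponentsAreEvenCyclesOrPaths G
    triangle-free⇒components {G} triangle-free b x =
      case component-shape G colour colour-comm colour-cong
        (λ {x} {y} {z} y≉z xy xz → proper
          ((λ x≈y → Graph.adj-irr G x≈y xy) , (λ x≈z → Graph.adj-irr G x≈z xz) , y≉z)
          xy xz (triangle-free xy xz)) x of λ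
        { (inj₁ even-cycle) → inj₁ even-cycle
        ; (inj₂ path-like)  → inj₂ (inj₁ path-like) }
      where open EdgeColouring (edgeColouring {G = G} b)

    bipartites⇒P₉-or-components : ∀ {U : Graph V} → Bipartite (S U) → Bipartite (S (complement U)) →
      InducedSubgraphOf U P₉ ⊎ ComponentsAreEvenCyclesOrPaths U ⊎ ComponentsAreEvenCyclesOrPaths (complement U)
    bipartites⇒P₉-or-components {U} b b̅ with em (HasTriangle U) | em (HasTriangle (complement U))
      where
      HasTriangle : Graph V → Set
      HasTriangle G = ∃[ x ] ∃[ y ] ∃[ z ] Adj G x y × Adj G x z × Adj G y z
    ... | no none | _ = inj₂ (inj₁ (triangle-free⇒components (λ xy xz yz → none (_ , _ , _ , xy , xz , yz)) b))
    ... | yes _ | no none = inj₂ (inj₂ (triangle-free⇒components (λ xy xz yz → none (_ , _ , _ , xy , xz , yz)) b̅))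
    ... | yes (_ , _ , _ , ab , ac , bc) | yes (_ , _ , _ , (d≉e , de) , (d≉f , df) , (e≉f , ef)) =
      inj₁ (induced-in-P₉ A (bull-exists A (⌊⌋-true ab , ⌊⌋-true ac , ⌊⌋-true bc)
        ((d≉e , d≉f , e≉f) , ⌊⌋-false de , ⌊⌋-false df , ⌊⌋-false ef)))
      where
      A : Alternating U
      A = bipartites⇒alternating b b̅

    P₉-or-components⇒alternating : ∀ {U : Graph V} →
      InducedSubgraphOf U P₉ ⊎ ComponentsAreEvenCyclesOrPaths U ⊎ ComponentsAreEvenCyclesOrPaths (complement U) →
      Alternating U
    P₉-or-components⇒alternating (inj₁ induced)       = P₉-alternating induced
    P₉-or-components⇒alternating (inj₂ (inj₁ comps))  = components⇒alternating comps
    P₉-or-components⇒alternating {U} (inj₂ (inj₂ comps)) =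
      -- The colouring for `complement U` also serves the complement of that graph, which
      -- classically is `U` again.
      alternating-cong {G = complement (complement U)} (λ _ _ → complement-involutive U)
        (complement-alternating {G = complement U} (components⇒alternating comps))

theorem1p2 : AxiomOfChoice → (V : Setoid 0ℓ 0ℓ) (U : Graph V) →
    ((Σ[ G ∈ Graph V ] Σ[ G′ ∈ Graph V ] SameHomogeneousTriples G G′ × U ≐ G ∔ G′)
    ⇔ (Bipartite (S U) × Bipartite (S (complement U))))
    ×
    ((Bipartite (S U) × Bipartite (S (complement U)))
    ⇔ (InducedSubgraphOf U P₉
    ⊎ (ComponentsAreEvenCyclesOrPaths U
    ⊎ ComponentsAreEvenCyclesOrPaths (complement U))))
theorem1p2 choice V U =
    mk⇔ (λ (G , G′ , same , U≐) → alternating⇒bipartites {U = U} (sameTriples⇒alternating {U = U} {G} {G′} same U≐))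
        (λ (b , b̅) → alternating⇒sameTriples {U = U} (bipartites⇒alternating b b̅))
  , mk⇔ (λ (b , b̅) → bipartites⇒P₉-or-components b b̅)
        (λ shape → alternating⇒bipartites {U = U} (P₉-or-components⇒alternating shape))
  where open Classical choice
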